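{- For every integer $n\geq 0$, the following three identities hold (as polynomial identities in the indeterminate $q$): \begin{align*} C_n&=\sum_{k=0}^{n}\frac{2k+1}{2n+1}\binom{2n+1}{n-k}\,\mathfrak{N}_k(q)\,(1-q)^{n-k},\\ q^{\frac{n}{2}+1}C_{\frac{n}{2}}&=\sum_{k=0}^{n}(-1)^{n-k}\binom{n}{k}\,\mathfrak{N}_{k+1}(q)\,(1+q)^{n-k},\\ q^{n+2}C_{n+1}&=\sum_{k=0}^{n}(-1)^{n-k}\binom{n}{k}\,\mathfrak{N}_{k+1}(q^2)\,(1-q)^{2(n-k)}, \end{align*} where in the second identity $C_{\frac n2}$ is interpreted as $0$ if $n$ is odd (so that the left-hand side is then $0$).
   Context: The Catalan numbers are $C_n=\frac{1}{n+1}\binom{2n}{n}$ for $n\ge 0$. The Narayana polynomials are $\mathfrak{N}_0(q)=1$ and, for $n\ge 1$, $\mathfrak{N}_n(q)=\sum_{k=1}^n\frac{1}{n}\binom{n}{k-1}\binom{n}{k}q^{k}$. -}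

module Defs where

open import Algebra.Bundles.Raw using (RawRing)
import Algebra.Definitions.RawSemiring as RawSemiringDefinitions
open import Data.Bool.Base using (if_then_else_)
open import Data.Fin.Base using (toℕ)
open import Data.Integer.Base using (+_)
open import Data.List.Base using (List; []; _∷_; map)
open import Data.Nat.Base as ℕ using (ℕ; zero; suc)
open import Data.Nat.Combinatorics using (_C_)
open import Data.Nat.Divisibility using (_∣?_)
open import Data.Nat.DivMod using (_/_)
open import Data.Rational.Base as ℚ using (ℚ; 0ℚ; 1ℚ)
open import Function.Base using (_∘_)
open import Level using (0ℓ)
open import Relation.Binary.PropositionalEquality.Core using (_≡_)
open import Relation.Nullary.Decidable.Core using (does)

fromℕ : ℕ → ℚ
fromℕ n = + n ℚ./ 1

-- ℚ[q]: lists of coefficients, constant term first.  Trailing zeros are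
-- allowed, so the equality of polynomials is equality of all coefficients.

Poly : Set
Poly = List ℚ

coeff : Poly → ℕ → ℚ
coeff []      _       = 0ℚ
coeff (a ∷ _) zero    = a
coeff (_ ∷ p) (suc i) = coeff p i

const : ℚ → Poly
const a = a ∷ []

q : Poly
q = 0ℚ ∷ 1ℚ ∷ []

addPoly : Poly → Poly → Poly
addPoly []      r       = r
addPoly (a ∷ p) []      = a ∷ p
addPoly (a ∷ p) (b ∷ r) = a ℚ.+ b ∷ addPoly p r

mulPoly : Poly → Poly → Poly
mulPoly []      r = []
mulPoly (a ∷ p) r = addPoly (map (a ℚ.*_) r) (0ℚ ∷ mulPoly p r)

polyRawRing : RawRing 0ℓ 0ℓ
polyRawRing = record
  { Carrier = Poly
  ; _≈_     = λ p r → ∀ i → coeff p i ≡ coeff r i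
  ; _+_     = addPoly
  ; _*_     = mulPoly
  ; -_      = map (λ a → ℚ.- a)
  ; 0#      = []
  ; 1#      = const 1ℚ
  }

open RawRing polyRawRing public using (_≈_; _+_; _*_; -_; 0#; 1#; rawSemiring)
open RawSemiringDefinitions rawSemiring public using (_^_; sum)

infixl 6 _-_
_-_ : Poly → Poly → Poly
p - r = p + (- r)

-- p ⟦ r ⟧ is p(r), the substitution of r for the indeterminate in p.

infix 9 _⟦_⟧
_⟦_⟧ : Poly → Poly → Poly
[]      ⟦ r ⟧ = 0#
(a ∷ p) ⟦ r ⟧ = const a + r * p ⟦ r ⟧

∑ : ℕ → (ℕ → Poly) → Poly
∑ n f = sum {suc n} (f ∘ toℕ)

infixl 5 ∑
syntax ∑ n (λ k → e) = ∑[ k ≤ n ] e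

catalan : ℕ → ℚ
catalan n = (+ 1 ℚ./ suc n) ℚ.* fromℕ ((2 ℕ.* n) C n)

-- catalan (n / 2) for even n, and 0 for odd n.

catalanHalf : ℕ → ℚ
catalanHalf n = if does (2 ∣? n) then catalan (n / 2) else 0ℚ

-- For n = suc m the summation index j is k − 1, where k runs from 1 to n.

𝔑 : ℕ → Poly
𝔑 zero      = 1#
𝔑 n@(suc m) =
  ∑[ j ≤ m ] const ((+ 1 ℚ./ n) ℚ.* fromℕ (n C j) ℚ.* fromℕ (n C suc j)) * q ^ suc j

{-# OPTIONS --safe #-}

-- The Narayana series N(z) = Σ 𝔑ₙ zⁿ satisfies N = 1 + z N (N - c) with
-- c = 1 - q, and with the Catalan series C it satisfies
-- C(z) = C(cz) N(z C(cz)²); comparing coefficients of zⁿ gives the first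
-- identity.  For the other two, 𝔑ₙ₊₁ = q μₙ, where μₙ counts Motzkin paths whose
-- level steps have weight 1 + q and whose down steps have weight q.  The binomial
-- transform by d adds d to the weight of the level steps; d = -(1 + q) leaves
-- weighted Dyck paths, and, after q ↦ q², d = -(1 - q)² leaves paths with step
-- polynomial t + 2q + q²/t = (t + q)²/t.  Both are counted by ballot numbers.
-- The coefficients of 𝔑ₙ, of the powers of N and of the Motzkin polynomials are
-- matched through their expressions as 2 × 2 determinants of binomials, which
-- reduces all the recurrences to Pascal's rule.

module Submission where

open import Algebra.Bundles using (CommutativeRing; Semiring)
open import Data.Bool.Base using (if_then_else_)
open import Data.Fin.Base using (toℕ)
open import Data.Fin.Properties using (toℕ<n)
open import Data.Integer.Base using (+_)
import Data.Integer.Properties as ℤ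
open import Data.Integer.Solver using () renaming (module +-*-Solver to ℤ-Solver)
open import Data.List.Base using ([]; _∷_; map)
open import Data.Nat.Base as ℕ using (ℕ; zero; suc; _∸_; s≤s; z≤n)
open import Data.Nat.Combinatorics using (_C_; nCk+nC[k+1]≡[n+1]C[k+1]; k>n⇒nCk≡0; nC1≡n; nCk≡nC[n∸k])
open import Data.Nat.Divisibility using (_∣_; _∣?_; divides; ∣m∣n⇒∣m+n; ∣-refl)
open import Data.Nat.DivMod using (_/_; m*[n/m]≡n)
import Data.Nat.Properties as ℕ
open import Data.Nat.Solver using (module +-*-Solver)
open import Data.Rational.Base as ℚ using (ℚ; 0ℚ; 1ℚ)
import Data.Rational.Properties as ℚ
open import Data.Rational.Solver using () renaming (module +-*-Solver to ℚ-Solver)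
open import Data.Rational.Unnormalised.Base as ℚᵘ using (mkℚᵘ; *≡*)
import Data.Rational.Unnormalised.Properties as ℚᵘ
open import Function.Base using (_∘_)
open import Level using (0ℓ)
open import Relation.Binary.PropositionalEquality as ≡ using (_≡_)
open import Relation.Nullary.Decidable using (Dec; yes; no; dec-true; dec-false)
open import Relation.Nullary.Negation.Core using (¬_; contradiction)
open +-*-Solver using () renaming
  (solve to ℕ-solve; con to ℕ-con; _:+_ to _ℕ-:+_; _:*_ to _ℕ-:*_; _:=_ to _ℕ-:=_)

-- The substitution arises as follows. Put D = C(cz), so that c z D² = D - 1, and F = D N(z D²).
-- Multiplying the equation of N by D gives F = D + z D F² - (D - 1) F, hence F = 1 + z F², and so F
-- = C. No series in z is formed. Multiplying C = 1 + z C² and N = 1 + z N (N - c) by a j-th power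
-- turns each quadratic equation into a linear recursion for the coefficients of all powers;
-- `ballot` and `power` are defined by these recursions. The induction for the first identity
-- therefore has to carry every j, and j = 1 is taken at the end. The Motzkin determinants come from
-- the factorisation t + (1 + q) + q/t = (1 + t)(1 + q/t): unrestricted paths are counted by
-- products of two binomials, and reflection at height -1 subtracts a second such product. Constant
-- coefficients belong to column -1 of Pascal's triangle, which is why they are treated separately.

-- ballot m j is the coefficient of z^m in the j-th power of the generating
-- function of the Catalan numbers.
ballot : ℕ → ℕ → ℕ
ballot zero    j       = 1
ballot (suc m) zero    = 0
ballot (suc m) (suc j) = ballot (suc m) j ℕ.+ ballot m (suc (suc j))

module RingIdentities {a ℓ} (R : CommutativeRing a ℓ) where
  open CommutativeRing R
  open import Algebra.Definitions.RawSemiring (Semiring.rawSemiring semiring) using (sum; _^_; _×_)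
  open import Algebra.Properties.CommutativeMonoid.Sum +-commutativeMonoid using (sum-cong-≋; ∑-distrib-+)
  open import Algebra.Properties.Semiring.Exp semiring using (^-congʳ; ^-congˡ; ^-homo-*)
  open import Algebra.Properties.CommutativeSemiring.Exp commutativeSemiring using (^-distrib-*)
  open import Algebra.Properties.Ring ring using (-1*x≈-x)
  open import Algebra.Properties.Semiring.Mult semiring using (×-homo-+; ×-congˡ)
  open import Algebra.Properties.Semiring.Sum semiring using (*-distribˡ-sum)
  open import Algebra.Solver.Ring.NaturalCoefficients.Default commutativeSemiring
  open import Relation.Binary.Reasoning.Setoid setoid

  -- Finite sums and the binomial transform in a commutative ring.

  ∑< : ℕ → (ℕ → Carrier) → Carrier
  ∑< n f = sum {n} (f ∘ toℕ)

  ∑<-cong : ∀ n {f g : ℕ → Carrier} → (∀ k → k ℕ.< n → f k ≈ g k) → ∑< n f ≈ ∑< n g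
  ∑<-cong n f≈g = sum-cong-≋ {n} λ i → f≈g (toℕ i) (toℕ<n i)

  ∑<-distrib-+ : ∀ n (f g : ℕ → Carrier) → ∑< n (λ k → f k + g k) ≈ ∑< n f + ∑< n g
  ∑<-distrib-+ n f g = ∑-distrib-+ {n} (f ∘ toℕ) (g ∘ toℕ)

  ∑<-distribˡ-* : ∀ n x (f : ℕ → Carrier) → x * ∑< n f ≈ ∑< n (λ k → x * f k)
  ∑<-distribˡ-* n x f = *-distribˡ-sum {n} x (f ∘ toℕ)

  ∑<-last : ∀ n (f : ℕ → Carrier) → ∑< (suc n) f ≈ ∑< n f + f n
  ∑<-last zero    f = +-comm _ _
  ∑<-last (suc n) f = trans (+-congˡ (∑<-last n (f ∘ suc))) (sym (+-assoc _ _ _))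

  ι : ℕ → Carrier
  ι n = n × 1#

  ι-cong : ∀ {m n} → m ≡ n → ι m ≈ ι n
  ι-cong = ×-congˡ

  ι-+ : ∀ m n → ι (m ℕ.+ n) ≈ ι m + ι n
  ι-+ = ×-homo-+ 1#

  x+y-y≈x : ∀ x y → x - y + y ≈ x
  x+y-y≈x x y = trans (+-assoc x (- y) y) (trans (+-congˡ (-‿inverseˡ y)) (+-identityʳ x))

  ^-suc∸ : ∀ x {n k} → k ℕ.≤ n → x ^ (suc n ∸ k) ≈ x * x ^ (n ∸ k)
  ^-suc∸ x k≤n = ^-congʳ x (ℕ.+-∸-assoc 1 k≤n)

  -- The entry at 0 of (d + E)^n applied to `x`, where E is the shift of sequences.
  binomialTransform : Carrier → ℕ → (ℕ → Carrier) → Carrier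
  binomialTransform d zero    x = x 0
  binomialTransform d (suc n) x = d * binomialTransform d n x + binomialTransform d n (x ∘ suc)

  binomialTransform-∑ : ∀ d n x →
    ∑< (suc n) (λ k → ι (n C k) * x k * d ^ (n ∸ k)) ≈ binomialTransform d n x
  binomialTransform-∑ d zero    x =
    solve 1 (λ y → (con 1 :+ con 0) :* y :* con 1 :+ con 0 := y) refl (x 0)
  binomialTransform-∑ d (suc n) x = begin
    t 0 + ∑< (suc n) (t ∘ suc)
      ≈⟨ +-congˡ (∑<-cong (suc n) λ k _ → pascal k) ⟩
    t 0 + ∑< (suc n) (λ k → u k + v k)
      ≈⟨ +-congˡ (∑<-distrib-+ (suc n) u v) ⟩
    t 0 + (∑< (suc n) u + ∑< (suc n) v)
      ≈⟨ solve 3 (λ p r s → p :+ (r :+ s) := (p :+ s) :+ r) refl _ _ _ ⟩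
    (t 0 + ∑< (suc n) v) + ∑< (suc n) u
      ≈⟨ +-congʳ (+-cong (first) (trans (∑<-last n v) (trans (+-congˡ v-last) (+-identityʳ _)))) ⟩
    (d * s 0 + ∑< n v) + ∑< (suc n) u
      ≈⟨ +-congʳ (+-congˡ (∑<-cong n v≈ds)) ⟩
    (d * s 0 + ∑< n (λ k → d * s (suc k))) + ∑< (suc n) u
      ≈⟨ +-congʳ (∑<-distribˡ-* (suc n) d s) ⟨
    d * ∑< (suc n) s + ∑< (suc n) u
      ≈⟨ +-cong (*-congˡ (binomialTransform-∑ d n x)) (binomialTransform-∑ d n (x ∘ suc)) ⟩
    d * binomialTransform d n x + binomialTransform d n (x ∘ suc) ∎
    where
    s t u v : ℕ → Carrier
    s k = ι (n C k) * x k * d ^ (n ∸ k)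
    t k = ι (suc n C k) * x k * d ^ (suc n ∸ k)
    u k = ι (n C k) * x (suc k) * d ^ (n ∸ k)
    v k = ι (n C suc k) * x (suc k) * d ^ (n ∸ k)

    pascal : ∀ k → t (suc k) ≈ u k + v k
    pascal k = begin
      ι (suc n C suc k) * x (suc k) * d ^ (n ∸ k)
        ≈⟨ *-congʳ (*-congʳ (trans (ι-cong (≡.sym (nCk+nC[k+1]≡[n+1]C[k+1] n k))) (ι-+ (n C k) _))) ⟩
      (ι (n C k) + ι (n C suc k)) * x (suc k) * d ^ (n ∸ k)
        ≈⟨ solve 4 (λ p r y z → (p :+ r) :* y :* z := p :* y :* z :+ r :* y :* z) refl _ _ _ _ ⟩
      u k + v k ∎

    first : t 0 ≈ d * s 0
    first = solve 3 (λ y e z → (con 1 :+ con 0) :* y :* (e :* z) := e :* ((con 1 :+ con 0) :* y :* z))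
        refl (x 0) d (d ^ n)

    -- The top term is split off because a factor `d` can be taken out of `d ^ (n ∸ k)` only while
    -- `k < n`; at `k = n` the binomial vanishes instead.
    v-last : v n ≈ 0#
    v-last = trans (*-congʳ (*-congʳ (ι-cong (k>n⇒nCk≡0 (ℕ.n<1+n n)))))
      (solve 2 (λ y z → con 0 :* y :* z := con 0) refl _ _)

    v≈ds : ∀ k → k ℕ.< n → v k ≈ d * s (suc k)
    v≈ds k k<n = trans (*-congˡ (^-suc∸ d k<n))
      (solve 3 (λ y e z → y :* (e :* z) := e :* (y :* z)) refl _ _ _)

  binomialTransform-cong : ∀ d n {x y} → (∀ k → x k ≈ y k) → binomialTransform d n x
      ≈ binomialTransform d n y
  binomialTransform-cong d zero    x≈y = x≈y 0
  binomialTransform-cong d (suc n) x≈y =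
    +-cong (*-congˡ (binomialTransform-cong d n x≈y)) (binomialTransform-cong d n (x≈y ∘ suc))

  binomialTransform-+ : ∀ d n x y →
    binomialTransform d n (λ k → x k + y k) ≈ binomialTransform d n x + binomialTransform d n y
  binomialTransform-+ d zero    x y = refl
  binomialTransform-+ d (suc n) x y = begin
    d * binomialTransform d n (λ k → x k + y k) + binomialTransform d n (λ k → x (suc k) + y (suc k))
      ≈⟨ +-cong (*-congˡ (binomialTransform-+ d n x y)) (binomialTransform-+ d n (x ∘ suc) (y ∘ suc)) ⟩
    _ ≈⟨ solve 5 (λ e p r s t → e :* (p :+ r) :+ (s :+ t) := (e :* p :+ s) :+ (e :* r :+ t)) refl _ _ _
        _ _ ⟩
    _ ∎

  binomialTransform-* : ∀ d n z x →
    binomialTransform d n (λ k → z * x k) ≈ z * binomialTransform d n x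
  binomialTransform-* d zero    z x = refl
  binomialTransform-* d (suc n) z x = begin
    d * binomialTransform d n (λ k → z * x k) + binomialTransform d n (λ k → z * x (suc k))
      ≈⟨ +-cong (*-congˡ (binomialTransform-* d n z x)) (binomialTransform-* d n z (x ∘ suc)) ⟩
    _ ≈⟨ solve 4 (λ e y p r → e :* (y :* p) :+ y :* r := y :* (e :* p :+ r)) refl _ _ _ _ ⟩
    _ ∎

  -- Weighted Motzkin paths.

  -- Weighted count of the Motzkin paths of length n from height 0 to height i,
  -- where level steps have weight b and down steps have weight w.
  motzkin : Carrier → Carrier → ℕ → ℕ → Carrier
  motzkin b w zero    zero    = 1#
  motzkin b w zero    (suc i) = 0#
  motzkin b w (suc n) zero    = b * motzkin b w n 0 + w * motzkin b w n 1
  motzkin b w (suc n) (suc i) =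
      motzkin b w n i + (b * motzkin b w n (suc i) + w * motzkin b w n (suc (suc i)))

  motzkin-congˡ : ∀ {b b′} w n i → b ≈ b′ → motzkin b w n i ≈ motzkin b′ w n i
  motzkin-congˡ w zero    zero    b≈b′ = refl
  motzkin-congˡ w zero    (suc i) b≈b′ = refl
  motzkin-congˡ w (suc n) zero    b≈b′ =
    +-cong (*-cong b≈b′ (motzkin-congˡ w n 0 b≈b′)) (*-congˡ (motzkin-congˡ w n 1 b≈b′))
  motzkin-congˡ w (suc n) (suc i) b≈b′ =
    +-cong (motzkin-congˡ w n i b≈b′)
      (+-cong (*-cong b≈b′ (motzkin-congˡ w n (suc i) b≈b′))
          (*-congˡ (motzkin-congˡ w n (suc (suc i)) b≈b′)))

  -- Read each level step of weight `b + d` as one of weight `b` or one of weight `d`. Deleting the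
  -- n - k steps of weight `d` changes no height, and C(n, k) counts their possible positions. All
  -- end heights are treated together because the recursion links neighbouring ones.
  binomialTransform-motzkin : ∀ b w d n i →
    binomialTransform d n (λ k → motzkin b w k i) ≈ motzkin (b + d) w n i
  binomialTransform-motzkin b w d zero    zero    = refl
  binomialTransform-motzkin b w d zero    (suc i) = refl
  binomialTransform-motzkin b w d (suc n) zero    = begin
    d * T 0 + binomialTransform d n (λ k → b * motzkin b w k 0 + w * motzkin b w k 1)
      ≈⟨ +-congˡ (trans (binomialTransform-+ d n _ _)
           (+-cong (binomialTransform-* d n b _) (binomialTransform-* d n w _))) ⟩
    d * T 0 + (b * T 0 + w * T 1)
      ≈⟨ solve 5 (λ e c y s t → e :* s :+ (c :* s :+ y :* t) := (c :+ e) :* s :+ y :* t) refl d b w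
           (T 0) (T 1) ⟩
    (b + d) * T 0 + w * T 1
      ≈⟨ +-cong (*-congˡ (binomialTransform-motzkin b w d n 0))
           (*-congˡ (binomialTransform-motzkin b w d n 1)) ⟩
    (b + d) * motzkin (b + d) w n 0 + w * motzkin (b + d) w n 1 ∎
    where
    T : ℕ → Carrier
    T i = binomialTransform d n (λ k → motzkin b w k i)
  binomialTransform-motzkin b w d (suc n) (suc i) = begin
    d * T (suc i) + binomialTransform d n
        (λ k → motzkin b w k i + (b * motzkin b w k (suc i) + w * motzkin b w k (suc (suc i))))
      ≈⟨ +-congˡ (trans (binomialTransform-+ d n _ _) (+-congˡ (trans (binomialTransform-+ d n _ _)
           (+-cong (binomialTransform-* d n b _) (binomialTransform-* d n w _))))) ⟩
    d * T (suc i) + (T i + (b * T (suc i) + w * T (suc (suc i))))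
      ≈⟨ solve 6 (λ e c y r s t → e :* s :+ (r :+ (c :* s :+ y :* t)) := r :+ ((c :+ e) :* s :+ y :* t))
           refl d b w (T i) _ _ ⟩
    T i + ((b + d) * T (suc i) + w * T (suc (suc i)))
      ≈⟨ +-cong (binomialTransform-motzkin b w d n i)
           (+-cong (*-congˡ (binomialTransform-motzkin b w d n (suc i)))
               (*-congˡ (binomialTransform-motzkin b w d n (suc (suc i))))) ⟩
    motzkin (b + d) w (suc n) (suc i) ∎
    where
    T : ℕ → Carrier
    T i = binomialTransform d n (λ k → motzkin b w k i)

  motzkin-above : ∀ b w {n i} → n ℕ.< i → motzkin b w n i ≈ 0#
  motzkin-above b w {zero}  {suc i} _ = refl
  motzkin-above b w {suc n} {suc i} (s≤s n<i) = begin
    motzkin b w n i + (b * motzkin b w n (suc i) + w * motzkin b w n (suc (suc i)))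
      ≈⟨ +-cong (motzkin-above b w n<i) (+-cong (*-congˡ (motzkin-above b w (ℕ.m<n⇒m<1+n n<i)))
           (*-congˡ (motzkin-above b w (ℕ.m<n⇒m<1+n (ℕ.m<n⇒m<1+n n<i))))) ⟩
    0# + (b * 0# + w * 0#)
      ≈⟨ solve 2 (λ c y → con 0 :+ (c :* con 0 :+ y :* con 0) := con 0) refl b w ⟩
    0# ∎

  -- Without level steps every step changes the height by one, so length and end height have the
  -- same parity.
  motzkin-odd : ∀ w n i → ¬ 2 ∣ n ℕ.+ i → motzkin 0# w n i ≈ 0#
  motzkin-odd w zero    zero    2∤n+i = contradiction (divides 0 ≡.refl) 2∤n+i
  motzkin-odd w zero    (suc i) 2∤n+i = refl
  motzkin-odd w (suc n) zero    2∤n+i = begin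
    0# * motzkin 0# w n 0 + w * motzkin 0# w n 1
      ≈⟨ +-congˡ (*-congˡ (motzkin-odd w n 1 (2∤n+i ∘ ≡.subst (2 ∣_) (ℕ.+-suc n 0)))) ⟩
    0# * motzkin 0# w n 0 + w * 0#
      ≈⟨ solve 2 (λ y r → con 0 :* r :+ y :* con 0 := con 0) refl w _ ⟩
    0# ∎
  motzkin-odd w (suc n) (suc i) 2∤n+i = begin
    motzkin 0# w n i + (0# * motzkin 0# w n (suc i) + w * motzkin 0# w n (suc (suc i)))
      ≈⟨ +-cong (motzkin-odd w n i
           (2∤n+i ∘ ≡.subst (2 ∣_) (≡.cong suc (≡.sym (ℕ.+-suc n i))) ∘ ∣m∣n⇒∣m+n ∣-refl))
           (+-congˡ (*-congˡ (motzkin-odd w n (suc (suc i))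
               (2∤n+i ∘ ≡.subst (2 ∣_) (ℕ.+-suc n (suc i)))))) ⟩
    0# + (0# * motzkin 0# w n (suc i) + w * 0#)
      ≈⟨ solve 2 (λ y r → con 0 :+ (con 0 :* r :+ y :* con 0) := con 0) refl w _ ⟩
    0# ∎

  -- Such a path has m down steps, and its last up steps to the heights 1, ..., i cut it into i + 1
  -- Dyck paths, whence the power i + 1 of the Catalan series. The two summands of `ballot`
  -- correspond to a last step going up or down.
  motzkin-dyck : ∀ w n m i → n ≡ 2 ℕ.* m ℕ.+ i → motzkin 0# w n i ≈ w ^ m * ι (ballot m (suc i))
  motzkin-dyck w zero    zero    zero    _ = solve 0 (con 1 := con 1 :* (con 1 :+ con 0)) refl
  motzkin-dyck w (suc n) zero    (suc i) n≡ = begin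
    motzkin 0# w n i + (0# * motzkin 0# w n (suc i) + w * motzkin 0# w n (suc (suc i)))
      ≈⟨ +-cong (motzkin-dyck w n 0 i n≡i)
           (+-congˡ (*-congˡ (motzkin-above 0# w (ℕ.m<n⇒m<1+n (ℕ.≤-reflexive (≡.cong suc n≡i)))))) ⟩
    1# * (1# + 0#) + (0# * motzkin 0# w n (suc i) + w * 0#)
      ≈⟨ solve 2 (λ y r → con 1 :* (con 1 :+ con 0) :+ (con 0 :* r :+ y :* con 0) := con 1 :*
           (con 1 :+ con 0)) refl w _ ⟩
    1# * (1# + 0#) ∎
    where
    n≡i : n ≡ i
    n≡i = ℕ.suc-injective n≡
  motzkin-dyck w (suc n) (suc m) zero    n≡ = begin
    0# * motzkin 0# w n 0 + w * motzkin 0# w n 1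
      ≈⟨ +-congˡ (*-congˡ (motzkin-dyck w n m 1 (ℕ.suc-injective (≡.trans n≡ index)))) ⟩
    0# * motzkin 0# w n 0 + w * (w ^ m * ι (ballot m 2))
      ≈⟨ solve 4 (λ y r z t → con 0 :* r :+ y :* (z :* t) := y :* z :* t) refl w _ _ _ ⟩
    w ^ suc m * ι (ballot m 2) ∎
    where
    index : 2 ℕ.* suc m ℕ.+ 0 ≡ suc (2 ℕ.* m ℕ.+ 1)
    index = ℕ-solve 1 (λ m → ℕ-con 2 ℕ-:* (ℕ-con 1 ℕ-:+ m) ℕ-:+ ℕ-con 0 ℕ-:= ℕ-con 1 ℕ-:+
        (ℕ-con 2 ℕ-:* m ℕ-:+ ℕ-con 1)) ≡.refl m
  motzkin-dyck w (suc n) (suc m) (suc i) n≡ = begin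
    motzkin 0# w n i + (0# * motzkin 0# w n (suc i) + w * motzkin 0# w n (suc (suc i)))
      ≈⟨ +-cong (motzkin-dyck w n (suc m) i (ℕ.suc-injective (≡.trans n≡ (ℕ.+-suc _ i))))
           (+-congˡ (*-congˡ (motzkin-dyck w n m (suc (suc i)) (ℕ.suc-injective (≡.trans n≡ index))))) ⟩
    w * w ^ m * ι (ballot (suc m) (suc i)) +
        (0# * motzkin 0# w n (suc i) + w * (w ^ m * ι (ballot m (suc (suc (suc i))))))
      ≈⟨ solve 5 (λ y r z s t → y :* z :* s :+ (con 0 :* r :+ y :* (z :* t)) := y :* z :* (s :+ t)) refl
           w _ _ _ _ ⟩
    w ^ suc m * (ι (ballot (suc m) (suc i)) + ι (ballot m (suc (suc (suc i)))))
      ≈⟨ *-congˡ (ι-+ (ballot (suc m) (suc i)) _) ⟨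
    w ^ suc m * ι (ballot (suc m) (suc (suc i))) ∎
    where
    index : 2 ℕ.* suc m ℕ.+ suc i ≡ suc (2 ℕ.* m ℕ.+ suc (suc i))
    index = ℕ-solve 2 (λ m i → ℕ-con 2 ℕ-:* (ℕ-con 1 ℕ-:+ m) ℕ-:+ (ℕ-con 1 ℕ-:+ i)
      ℕ-:= ℕ-con 1 ℕ-:+ (ℕ-con 2 ℕ-:* m ℕ-:+ (ℕ-con 2 ℕ-:+ i))) ≡.refl m i

  -- With b = 2x and w = x² the generating function of the paths ending at
  -- height i is C(xz)² (z C(xz)²)^i, where C is that of the Catalan numbers.
  motzkin-square : ∀ x n m i → n ≡ m ℕ.+ i →
    motzkin (x + x) (x ^ 2) n i ≈ x ^ m * ι (ballot m (2 ℕ.+ 2 ℕ.* i))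
  motzkin-square x = go
    where
    b w : Carrier
    b = x + x
    w = x ^ 2

    above : ∀ {n i} → n ≡ i → motzkin b w n (suc i) ≈ 0#
    above n≡i = motzkin-above b w (s≤s (ℕ.≤-reflexive n≡i))

    κ : ℕ → ℕ → Carrier
    κ m i = ι (ballot m (2 ℕ.+ 2 ℕ.* i))

    ballot-index : ∀ m i → ballot m (2 ℕ.+ 2 ℕ.* suc i) ≡ ballot m (4 ℕ.+ 2 ℕ.* i)
    ballot-index m i = ≡.cong (ballot m ∘ suc ∘ suc) (ℕ.*-suc 2 i)

    κ-one-zero : κ 1 0 ≈ κ 0 0 + κ 0 0
    κ-one-zero = ι-+ 1 1

    κ-one-suc : ∀ i → κ 1 (suc i) ≈ κ 1 i + (κ 0 (suc i) + κ 0 (suc i))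
    κ-one-suc i = begin
      κ 1 (suc i) ≈⟨ ι-cong (ballot-index 1 i) ⟩
      ι (ballot 1 (2 ℕ.+ 2 ℕ.* i) ℕ.+ 1 ℕ.+ 1) ≈⟨ ι-+ (ballot 1 (2 ℕ.+ 2 ℕ.* i) ℕ.+ 1) 1 ⟩
      ι (ballot 1 (2 ℕ.+ 2 ℕ.* i) ℕ.+ 1) + ι 1 ≈⟨ +-congʳ (ι-+ (ballot 1 (2 ℕ.+ 2 ℕ.* i)) 1) ⟩
      κ 1 i + ι 1 + ι 1 ≈⟨ +-assoc _ _ _ ⟩
      κ 1 i + (ι 1 + ι 1) ∎

    κ-suc-zero : ∀ m → κ (suc (suc m)) 0 ≈ (κ (suc m) 0 + κ (suc m) 0) + κ m 1
    κ-suc-zero m = trans (ι-+ (ballot (suc m) 2) _)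
        (trans (+-congˡ (ι-+ (ballot (suc m) 2) (ballot m 4))) (sym (+-assoc _ _ _)))

    -- The ballot recursion is applied twice, once for each factor t + x of the step polynomial (t +
    -- x)²/t; the two mixed terms agree and account for the level weight 2x.
    κ-suc-suc : ∀ m i → κ (suc (suc m)) (suc i)
        ≈ κ (suc (suc m)) i + ((κ (suc m) (suc i) + κ (suc m) (suc i)) + κ m (suc (suc i)))
    κ-suc-suc m i = begin
      κ (suc (suc m)) (suc i)
        ≈⟨ ι-cong (ballot-index (suc (suc m)) i) ⟩
      ι (ballot (suc (suc m)) (2 ℕ.+ 2 ℕ.* i) ℕ.+ p ℕ.+ (p ℕ.+ r))
        ≈⟨ ι-+ (ballot (suc (suc m)) (2 ℕ.+ 2 ℕ.* i) ℕ.+ p) (p ℕ.+ r) ⟩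
      ι (ballot (suc (suc m)) (2 ℕ.+ 2 ℕ.* i) ℕ.+ p) + ι (p ℕ.+ r)
        ≈⟨ +-cong (ι-+ (ballot (suc (suc m)) (2 ℕ.+ 2 ℕ.* i)) p) (ι-+ p r) ⟩
      (κ (suc (suc m)) i + ι p) + (ι p + ι r)
        ≈⟨ solve 3 (λ s t u → (s :+ t) :+ (t :+ u) := s :+ ((t :+ t) :+ u)) refl _ _ _ ⟩
      κ (suc (suc m)) i + ((ι p + ι p) + ι r)
        ≈⟨ +-congˡ (+-cong (+-cong p≈ p≈) r≈) ⟩
      κ (suc (suc m)) i + ((κ (suc m) (suc i) + κ (suc m) (suc i)) + κ m (suc (suc i))) ∎
      where
      p r : ℕ
      p = ballot (suc m) (4 ℕ.+ 2 ℕ.* i)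
      r = ballot m (6 ℕ.+ 2 ℕ.* i)
      p≈ : ι p ≈ κ (suc m) (suc i)
      p≈ = ι-cong (≡.sym (ballot-index (suc m) i))
      r≈ : ι r ≈ κ m (suc (suc i))
      r≈ = ι-cong (≡.sym (≡.trans (ballot-index m (suc i))
          (≡.cong (λ j → ballot m (4 ℕ.+ j)) (ℕ.*-suc 2 i))))

    go : ∀ n m i → n ≡ m ℕ.+ i → motzkin b w n i ≈ x ^ m * κ m i
    go zero    zero    zero    _ = solve 0 (con 1 := con 1 :* (con 1 :+ con 0)) refl
    go (suc n) zero    (suc i) n≡ = begin
      motzkin b w n i + (b * motzkin b w n (suc i) + w * motzkin b w n (suc (suc i)))
        ≈⟨ +-cong (go n 0 i n≡i) (+-cong (*-congˡ (above n≡i))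
             (*-congˡ (motzkin-above b w (ℕ.m<n⇒m<1+n (s≤s (ℕ.≤-reflexive n≡i)))))) ⟩
      1# * κ 0 i + (b * 0# + w * 0#)
        ≈⟨ solve 3 (λ c y r → r :+ (c :* con 0 :+ y :* con 0) := r) refl b w _ ⟩
      1# * κ 0 (suc i) ∎
      where
      n≡i : n ≡ i
      n≡i = ℕ.suc-injective n≡
    -- The case `m = 1` stands apart because the twofold recursion reaches back to m - 2; here the
    -- paths before a last down step would end above every reachable height.
    go (suc n) (suc zero) zero n≡ = begin
      b * motzkin b w n 0 + w * motzkin b w n 1
        ≈⟨ +-cong (*-congˡ (go n 0 0 (ℕ.suc-injective n≡))) (*-congˡ (above (ℕ.suc-injective n≡))) ⟩
      b * (1# * κ 0 0) + w * 0#
        ≈⟨ solve 3 (λ x w r → (x :+ x) :* (con 1 :* r) :+ w :* con 0 := x :* con 1 :* (r :+ r)) refl x w _ ⟩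
      x ^ 1 * (κ 0 0 + κ 0 0)
        ≈⟨ *-congˡ κ-one-zero ⟨
      x ^ 1 * κ 1 0 ∎
    go (suc n) (suc (suc m)) zero n≡ = begin
      b * motzkin b w n 0 + w * motzkin b w n 1
        ≈⟨ +-cong (*-congˡ (go n (suc m) 0 n≡′)) (*-congˡ (go n m 1 (≡.trans n≡′ (≡.sym (ℕ.+-suc m 0))))) ⟩
      b * (x * x ^ m * κ (suc m) 0) + w * (x ^ m * κ m 1)
        ≈⟨ solve 4 (λ x y r s → (x :+ x) :* (x :* y :* r) :+ x :* (x :* con 1) :* (y :* s) := x :*
             (x :* y) :* ((r :+ r) :+ s)) refl x _ _ _ ⟩
      x ^ suc (suc m) * ((κ (suc m) 0 + κ (suc m) 0) + κ m 1)
        ≈⟨ *-congˡ (κ-suc-zero m) ⟨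
      x ^ suc (suc m) * κ (suc (suc m)) 0 ∎
      where
      n≡′ : n ≡ suc m ℕ.+ 0
      n≡′ = ℕ.suc-injective n≡
    go (suc n) (suc zero) (suc i) n≡ = begin
      motzkin b w n i + (b * motzkin b w n (suc i) + w * motzkin b w n (suc (suc i)))
        ≈⟨ +-cong (go n 1 i n≡′) (+-cong (*-congˡ (go n 0 (suc i) n≡′)) (*-congˡ (above n≡′))) ⟩
      x * 1# * κ 1 i + (b * (1# * κ 0 (suc i)) + w * 0#)
        ≈⟨ solve 4 (λ x w r s → x :* con 1 :* r :+ ((x :+ x) :* (con 1 :* s) :+ w :* con 0) := x :* con
             1 :* (r :+ (s :+ s))) refl x w _ _ ⟩
      x ^ 1 * (κ 1 i + (κ 0 (suc i) + κ 0 (suc i)))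
        ≈⟨ *-congˡ (κ-one-suc i) ⟨
      x ^ 1 * κ 1 (suc i) ∎
      where
      n≡′ : n ≡ suc i
      n≡′ = ℕ.suc-injective n≡
    go (suc n) (suc (suc m)) (suc i) n≡ = begin
      motzkin b w n i + (b * motzkin b w n (suc i) + w * motzkin b w n (suc (suc i)))
        ≈⟨ +-cong (go n (suc (suc m)) i (≡.trans n≡′ (ℕ.+-suc (suc m) i)))
             (+-cong (*-congˡ (go n (suc m) (suc i) n≡′))
                 (*-congˡ (go n m (suc (suc i)) (≡.trans n≡′ (≡.sym (ℕ.+-suc m (suc i))))))) ⟩
      x * (x * x ^ m) * κ (suc (suc m)) i +
          (b * (x * x ^ m * κ (suc m) (suc i)) + w * (x ^ m * κ m (suc (suc i))))
        ≈⟨ solve 5 (λ x y t r s → x :* (x :* y) :* t :+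
             ((x :+ x) :* (x :* y :* r) :+ x :* (x :* con 1) :* (y :* s))
             := x :* (x :* y) :* (t :+ ((r :+ r) :+ s))) refl x _ _ _ _ ⟩
      x ^ suc (suc m) * (κ (suc (suc m)) i + ((κ (suc m) (suc i) + κ (suc m) (suc i)) + κ m (suc (suc i))))
        ≈⟨ *-congˡ (κ-suc-suc m i) ⟨
      x ^ suc (suc m) * κ (suc (suc m)) (suc i) ∎
      where
      n≡′ : n ≡ suc m ℕ.+ suc i
      n≡′ = ℕ.suc-injective n≡

  -- Powers of the Narayana series and the substitution identity.

  -- power c m j is the coefficient of z^m in N^j, where N = 1 + z N (N - c).
  power : Carrier → ℕ → ℕ → Carrier
  power c zero    j       = 1#
  power c (suc m) zero    = 0#
  power c (suc m) (suc j) = power c (suc m) j + (power c m (suc (suc j)) - c * power c m (suc j))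

  -- The substitution N (z C(cz)²) C(cz) = C(z), read off coefficientwise, for
  -- C the generating function of the Catalan numbers.
  ballot-power : ∀ c n j →
    ∑< (suc n) (λ k → ι (ballot (n ∸ k) (2 ℕ.* k ℕ.+ j)) * power c k j * c ^ (n ∸ k)) ≈ ι (ballot n j)
  ballot-power c zero    j = solve 0 ((con 1 :+ con 0) :* con 1 :* con 1 :+ con 0 := con 1 :+ con 0) refl
  ballot-power c (suc n) zero = begin
    0# * 1# * c ^ suc n + ∑< (suc n) t
      ≈⟨ +-congˡ (∑<-cong (suc n) {t} λ k _ →
           solve 2 (λ y z → y :* con 0 :* z := con 0 :* con 0) refl _ _) ⟩
    0# * 1# * c ^ suc n + ∑< (suc n) (λ k → 0# * 0#)
      ≈⟨ +-congˡ (∑<-distribˡ-* (suc n) 0# (λ _ → 0#)) ⟨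
    0# * 1# * c ^ suc n + 0# * ∑< (suc n) (λ k → 0#)
      ≈⟨ solve 2 (λ y z → con 0 :* con 1 :* y :+ con 0 :* z := con 0) refl _ _ ⟩
    0# ∎
    where
    t : ℕ → Carrier
    t k = ι (ballot (n ∸ k) (2 ℕ.* suc k ℕ.+ 0)) * 0# * c ^ (n ∸ k)
  ballot-power c (suc n) (suc j) = begin
    ∑< (suc (suc n)) L
      ≈⟨ ∑<-last (suc n) L ⟩
    ∑< (suc n) L + L (suc n)
      ≈⟨ +-cong (∑<-cong (suc n) L≈X+Y) L-last ⟩
    ∑< (suc n) (λ k → X k + Y k) + X (suc n)
      ≈⟨ +-congʳ (∑<-distrib-+ (suc n) X Y) ⟩
    (∑< (suc n) X + ∑< (suc n) Y) + X (suc n)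
      ≈⟨ solve 3 (λ r s t → (r :+ s) :+ t := (r :+ t) :+ s) refl _ _ _ ⟩
    (∑< (suc n) X + X (suc n)) + ∑< (suc n) Y
      ≈⟨ +-congʳ (∑<-last (suc n) X) ⟨
    (X 0 + ∑< (suc n) (X ∘ suc)) + ∑< (suc n) Y
      ≈⟨ trans (+-assoc _ _ _) (+-congˡ (sym (∑<-distrib-+ (suc n) (X ∘ suc) Y))) ⟩
    X 0 + ∑< (suc n) (λ k → X (suc k) + Y k)
      ≈⟨ +-congˡ (∑<-cong (suc n) X+Y≈P+Q) ⟩
    P 0 + ∑< (suc n) (λ k → P (suc k) + Q k)
      ≈⟨ trans (+-congˡ (∑<-distrib-+ (suc n) (P ∘ suc) Q)) (sym (+-assoc _ _ _)) ⟩
    ∑< (suc (suc n)) P + ∑< (suc n) Q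
      ≈⟨ +-cong (ballot-power c (suc n) j) (ballot-power c n (suc (suc j))) ⟩
    ι (ballot (suc n) j) + ι (ballot n (suc (suc j)))
      ≈⟨ ι-+ (ballot (suc n) j) _ ⟨
    ι (ballot (suc n) (suc j)) ∎
    where
    -- `X` and `Y` are the two parts into which the ballot recursion splits `L`; `P` and `Q` are the
    -- summands of the two sums known by induction.
    L P Q X Y : ℕ → Carrier
    L k = ι (ballot (suc n ∸ k) (2 ℕ.* k ℕ.+ suc j)) * power c k (suc j) * c ^ (suc n ∸ k)
    P k = ι (ballot (suc n ∸ k) (2 ℕ.* k ℕ.+ j)) * power c k j * c ^ (suc n ∸ k)
    Q k = ι (ballot (n ∸ k) (2 ℕ.* k ℕ.+ suc (suc j))) * power c k (suc (suc j)) * c ^ (n ∸ k)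
    X k = ι (ballot (suc n ∸ k) (2 ℕ.* k ℕ.+ j)) * power c k (suc j) * c ^ (suc n ∸ k)
    Y k = ι (ballot (n ∸ k) (2 ℕ.* k ℕ.+ suc (suc j))) * power c k (suc j) * c ^ (suc n ∸ k)

    ballot-split : ∀ k → k ℕ.≤ n → ballot (suc n ∸ k) (2 ℕ.* k ℕ.+ suc j)
      ≡ ballot (suc n ∸ k) (2 ℕ.* k ℕ.+ j) ℕ.+ ballot (n ∸ k) (2 ℕ.* k ℕ.+ suc (suc j))
    ballot-split k k≤n rewrite ℕ.+-∸-assoc 1 k≤n | ℕ.+-suc (2 ℕ.* k) (suc j) | ℕ.+-suc (2 ℕ.* k) j = ≡.refl

    L≈X+Y : ∀ k → k ℕ.< suc n → L k ≈ X k + Y k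
    L≈X+Y k (s≤s k≤n) = trans
      (*-congʳ (*-congʳ (trans (ι-cong (ballot-split k k≤n)) (ι-+ (ballot (suc n ∸ k) (2 ℕ.* k ℕ.+ j)) _))))
      (solve 4 (λ p r y z → (p :+ r) :* y :* z := p :* y :* z :+ r :* y :* z) refl _ _ _ _)

    L-last : L (suc n) ≈ X (suc n)
    L-last = *-congʳ (*-congʳ (ι-cong ballot-last))
      where
      ballot-last : ballot (n ∸ n) (2 ℕ.* suc n ℕ.+ suc j) ≡ ballot (n ∸ n) (2 ℕ.* suc n ℕ.+ j)
      ballot-last rewrite ℕ.n∸n≡0 n = ≡.refl

    -- After the shift of `X` by one, both terms carry the same ballot number. The recursion of
    -- `power` then produces a term with `- c * g′`, which `Y k` cancels thanks to its one extra
    -- factor `c`.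
    X+Y≈P+Q : ∀ k → k ℕ.< suc n → X (suc k) + Y k ≈ P (suc k) + Q k
    X+Y≈P+Q k (s≤s k≤n) = begin
      X (suc k) + Y k
        ≈⟨ +-cong (*-congʳ (*-congʳ h≈)) (*-congˡ (^-suc∸ c k≤n)) ⟩
      h * (g + (g″ - c * g′)) * e + h * g′ * (c * e)
        ≈⟨ solve 6 (λ h g d c g′ e →
             h :* (g :+ d) :* e :+ h :* g′ :* (c :* e) := h :* g :* e :+ h :* (d :+ c :* g′) :* e) refl
             h g (g″ - c * g′) c g′ e ⟩
      h * g * e + h * ((g″ - c * g′) + c * g′) * e
        ≈⟨ +-cong (*-congʳ (*-congʳ (sym h≈))) (*-congʳ (*-congˡ (x+y-y≈x g″ (c * g′)))) ⟩
      P (suc k) + Q k ∎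
      where
      h g g′ g″ e : Carrier
      h  = ι (ballot (n ∸ k) (2 ℕ.* k ℕ.+ suc (suc j)))
      g  = power c (suc k) j
      g′ = power c k (suc j)
      g″ = power c k (suc (suc j))
      e  = c ^ (n ∸ k)

      h≈ : ι (ballot (n ∸ k) (2 ℕ.* suc k ℕ.+ j)) ≈ h
      h≈ = ι-cong (≡.cong (ballot (n ∸ k)) (ℕ-solve 2 (λ k j →
        ℕ-con 2 ℕ-:* (ℕ-con 1 ℕ-:+ k) ℕ-:+ j ℕ-:= ℕ-con 2 ℕ-:* k ℕ-:+ (ℕ-con 2 ℕ-:+ j)) ≡.refl k j))

  -- The shapes of the three sums, over a commutative ring.

  -1^*-distrib : ∀ e a x n → (- 1#) ^ n * a * x * e ^ n ≈ a * x * (- e) ^ n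
  -1^*-distrib e a x n = begin
    (- 1#) ^ n * a * x * e ^ n
      ≈⟨ solve 4 (λ s a x t → s :* a :* x :* t := a :* x :* (s :* t)) refl _ a x _ ⟩
    a * x * ((- 1#) ^ n * e ^ n)  ≈⟨ *-congˡ (^-distrib-* (- 1#) e n) ⟨
    a * x * (- 1# * e) ^ n        ≈⟨ *-congˡ (^-congˡ n (-1*x≈-x e)) ⟩
    a * x * (- e) ^ n             ∎

  -- Serves the second and the third identity: the sign and the power of `e` combine into a binomial
  -- transform by `- e`. The powers enter through `p` because in one of the sums they are written
  -- with exponent 2 (n - k) instead of as powers of a square.
  alternating-motzkin : ∀ n y b w e (a x p : ℕ → Carrier) → (∀ k → a k ≈ ι (n C k)) →
    (∀ k → x k ≈ y * motzkin b w k 0) → (∀ k → p k ≈ e ^ (n ∸ k)) →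
    ∑< (suc n) (λ k → (- 1#) ^ (n ∸ k) * a k * x k * p k) ≈ y * motzkin (b - e) w n 0
  alternating-motzkin n y b w e a x p a≈ x≈ p≈ = begin
    ∑< (suc n) (λ k → (- 1#) ^ (n ∸ k) * a k * x k * p k)
      ≈⟨ ∑<-cong (suc n) (λ k _ →
           trans (*-cong (*-congʳ (*-congˡ (a≈ k))) (p≈ k)) (-1^*-distrib e (ι (n C k)) (x k) (n ∸ k))) ⟩
    ∑< (suc n) (λ k → ι (n C k) * x k * (- e) ^ (n ∸ k))
      ≈⟨ binomialTransform-∑ (- e) n x ⟩
    binomialTransform (- e) n x
      ≈⟨ binomialTransform-cong (- e) n x≈ ⟩
    binomialTransform (- e) n (λ k → y * motzkin b w k 0)
      ≈⟨ binomialTransform-* (- e) n y (λ k → motzkin b w k 0) ⟩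
    y * binomialTransform (- e) n (λ k → motzkin b w k 0)
      ≈⟨ *-congˡ (binomialTransform-motzkin b w (- e) n 0) ⟩
    y * motzkin (b - e) w n 0 ∎

  ballot-weighted-sum : ∀ n c (a x : ℕ → Carrier) →
    (∀ k → k ℕ.≤ n → a k ≈ ι (ballot (n ∸ k) (2 ℕ.* k ℕ.+ 1))) → (∀ k → x k ≈ power c k 1) →
    ∑< (suc n) (λ k → a k * x k * c ^ (n ∸ k)) ≈ ι (ballot n 1)
  ballot-weighted-sum n c a x a≈ x≈ = trans (∑<-cong (suc n) term≈) (ballot-power c n 1)
    where
    term≈ : ∀ k → k ℕ.< suc n → a k * x k * c ^ (n ∸ k)
      ≈ ι (ballot (n ∸ k) (2 ℕ.* k ℕ.+ 1)) * power c k 1 * c ^ (n ∸ k)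
    term≈ k (s≤s k≤n) = *-congʳ (*-cong (a≈ k k≤n) (x≈ k))

  ^-+-* : ∀ x m k {y z} → y ≈ z → x ^ (m ℕ.+ k) * y ≈ x ^ k * (x ^ m * z)
  ^-+-* x m k {y} {z} y≈z = begin
    x ^ (m ℕ.+ k) * y    ≈⟨ *-cong (^-homo-* x m k) y≈z ⟩
    x ^ m * x ^ k * z    ≈⟨ solve 3 (λ s t z → s :* t :* z := t :* (s :* z)) refl _ _ z ⟩
    x ^ k * (x ^ m * z)  ∎

  horner-+ : ∀ r x y u v {z} → z ≈ u + v → (x + y) + r * z ≈ (x + r * u) + (y + r * v)
  horner-+ r x y u v z≈u+v = trans (+-congˡ (*-congˡ z≈u+v))
    (solve 5 (λ r x y u v → (x :+ y) :+ r :* (u :+ v) := (x :+ r :* u) :+ (y :+ r :* v)) refl r x y u v)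

  horner-cong : ∀ r {x x′ z z′} → x ≈ x′ → z ≈ z′ → x + r * z ≈ x′ + r * z′
  horner-cong r x≈x′ z≈z′ = +-cong x≈x′ (*-congˡ z≈z′)

  0+r*0≈0 : ∀ r → 0# + r * 0# ≈ 0#
  0+r*0≈0 r = trans (+-identityˡ _) (zeroʳ r)

  x+r*x≈[1+r]*x : ∀ r x → x + r * x ≈ (1# + r) * x
  x+r*x≈[1+r]*x r x = solve 2 (λ r x → x :+ r :* x := (con 1 :+ r) :* x) refl r x

open import Algebra.Properties.Semiring.Exp using (^-assocʳ)
open import Data.Product.Base using (_×_; _,_)
open import Defs
open ≡ using (refl; sym; trans; cong; cong₂)

-- Closed form of the ballot numbers.

pascal : ∀ n k → suc n C suc k ≡ n C k ℕ.+ n C suc k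
pascal n k = sym (nCk+nC[k+1]≡[n+1]C[k+1] n k)

[1+k]*[1+n]C[1+k]≡[1+n]*nCk : ∀ n k → suc k ℕ.* (suc n C suc k) ≡ suc n ℕ.* (n C k)
[1+k]*[1+n]C[1+k]≡[1+n]*nCk n       zero    =
  trans (ℕ.*-identityˡ (suc n C 1)) (trans (nC1≡n (suc n)) (sym (ℕ.*-identityʳ (suc n))))
[1+k]*[1+n]C[1+k]≡[1+n]*nCk zero    (suc k) = begin
  suc (suc k) ℕ.* (1 C suc (suc k)) ≡⟨ cong (suc (suc k) ℕ.*_)
      (k>n⇒nCk≡0 {1} {suc (suc k)} (s≤s (s≤s z≤n))) ⟩
  suc (suc k) ℕ.* 0                 ≡⟨ ℕ.*-zeroʳ (suc (suc k)) ⟩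
  0                                 ≡⟨ ℕ.*-zeroʳ 1 ⟨
  1 ℕ.* 0                           ≡⟨ cong (1 ℕ.*_) (k>n⇒nCk≡0 {0} {suc k} (s≤s z≤n)) ⟨
  1 ℕ.* (0 C suc k)                 ∎
  where open ≡.≡-Reasoning
[1+k]*[1+n]C[1+k]≡[1+n]*nCk (suc n) (suc k) = begin
  suc (suc k) ℕ.* (suc (suc n) C suc (suc k))
    ≡⟨ cong (suc (suc k) ℕ.*_) (pascal (suc n) (suc k)) ⟩
  suc (suc k) ℕ.* (x ℕ.+ y)
    ≡⟨ ℕ-solve 3 (λ k x y → (ℕ-con 2 ℕ-:+ k) ℕ-:* (x ℕ-:+ y) ℕ-:= x ℕ-:+
         ((ℕ-con 1 ℕ-:+ k) ℕ-:* x ℕ-:+ (ℕ-con 2 ℕ-:+ k) ℕ-:* y)) refl k x y ⟩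
  x ℕ.+ (suc k ℕ.* x ℕ.+ suc (suc k) ℕ.* y)
    ≡⟨ cong (x ℕ.+_) (cong₂ ℕ._+_ ([1+k]*[1+n]C[1+k]≡[1+n]*nCk n k)
         ([1+k]*[1+n]C[1+k]≡[1+n]*nCk n (suc k))) ⟩
  x ℕ.+ (suc n ℕ.* (n C k) ℕ.+ suc n ℕ.* (n C suc k))
    ≡⟨ cong (x ℕ.+_) (ℕ.*-distribˡ-+ (suc n) (n C k) (n C suc k)) ⟨
  x ℕ.+ suc n ℕ.* (n C k ℕ.+ n C suc k)
    ≡⟨ cong (λ z → x ℕ.+ suc n ℕ.* z) (pascal n k) ⟨
  suc (suc n) ℕ.* x ∎
  where
  open ≡.≡-Reasoning
  x y : ℕ
  x = suc n C suc k
  y = suc n C suc (suc k)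

-- The additive form of (n + 1) C(n, k) = (n + 1 - k) C(n + 1, k) avoids truncated subtraction and
-- so is valid for every `k`.
[1+n]*nCk+k*[1+n]Ck≡[1+n]*[1+n]Ck : ∀ n k →
  suc n ℕ.* (n C k) ℕ.+ k ℕ.* (suc n C k) ≡ suc n ℕ.* (suc n C k)
[1+n]*nCk+k*[1+n]Ck≡[1+n]*[1+n]Ck n zero    = ℕ.+-identityʳ _
[1+n]*nCk+k*[1+n]Ck≡[1+n]*[1+n]Ck n (suc k) = begin
  suc n ℕ.* (n C suc k) ℕ.+ suc k ℕ.* (suc n C suc k)
    ≡⟨ cong (suc n ℕ.* (n C suc k) ℕ.+_) ([1+k]*[1+n]C[1+k]≡[1+n]*nCk n k) ⟩
  suc n ℕ.* (n C suc k) ℕ.+ suc n ℕ.* (n C k)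
    ≡⟨ ℕ.*-distribˡ-+ (suc n) (n C suc k) (n C k) ⟨
  suc n ℕ.* (n C suc k ℕ.+ n C k)
    ≡⟨ cong (suc n ℕ.*_) (trans (ℕ.+-comm (n C suc k) _) (sym (pascal n k))) ⟩
  suc n ℕ.* (suc n C suc k) ∎
  where open ≡.≡-Reasoning

ballot-one : ∀ j → ballot 1 j ≡ j
ballot-one zero    = refl
ballot-one (suc j) = trans (cong (ℕ._+ 1) (ballot-one j)) (ℕ.+-comm j 1)

central-symmetry : ∀ m → suc (2 ℕ.* m) C suc m ≡ suc (2 ℕ.* m) C m
central-symmetry m = trans (nCk≡nC[n∸k] (s≤s (ℕ.m≤m+n m _)))
  (cong (suc (2 ℕ.* m) C_) (trans (ℕ.m+n∸m≡n m (m ℕ.+ 0)) (ℕ.+-identityʳ m)))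

-- Pascal's rule makes the difference of binomials obey the ballot recursion. The formula at the two
-- earlier indices is taken as hypotheses because at `j = 0` the first of them is a symmetry of
-- binomials, not an inductive instance.
ballot-difference-step : ∀ m j → let N = suc (2 ℕ.* suc m) ℕ.+ j in
  ballot (suc (suc m)) j ℕ.+ N C suc m ≡ N C suc (suc m) →
  ballot (suc m) (suc (suc j)) ℕ.+ (suc (suc (2 ℕ.* m)) ℕ.+ suc j) C m
      ≡ (suc (suc (2 ℕ.* m)) ℕ.+ suc j) C suc m →
  ballot (suc (suc m)) (suc j) ℕ.+ suc N C suc m ≡ suc N C suc (suc m)
ballot-difference-step m j h₁ h₂ = begin
  a ℕ.+ b ℕ.+ suc N C suc m
    ≡⟨ cong (a ℕ.+ b ℕ.+_) (pascal N m) ⟩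
  a ℕ.+ b ℕ.+ (N C m ℕ.+ N C suc m)
    ≡⟨ ℕ-solve 4 (λ a b c d → a ℕ-:+ b ℕ-:+ (c ℕ-:+ d) ℕ-:= (a ℕ-:+ d) ℕ-:+ (b ℕ-:+ c)) refl a b (N C m)
         (N C suc m) ⟩
  (a ℕ.+ N C suc m) ℕ.+ (b ℕ.+ N C m)
    ≡⟨ cong₂ ℕ._+_ h₁ (≡.subst (λ n → b ℕ.+ n C m ≡ n C suc m) (sym N≡) h₂) ⟩
  N C suc (suc m) ℕ.+ N C suc m
    ≡⟨ ℕ.+-comm (N C suc (suc m)) _ ⟩
  N C suc m ℕ.+ N C suc (suc m)
    ≡⟨ pascal N (suc m) ⟨
  suc N C suc (suc m) ∎
  where
  open ≡.≡-Reasoning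
  a b N : ℕ
  a = ballot (suc (suc m)) j
  b = ballot (suc m) (suc (suc j))
  N = suc (2 ℕ.* suc m) ℕ.+ j

  N≡ : N ≡ suc (suc (2 ℕ.* m)) ℕ.+ suc j
  N≡ = ℕ-solve 2 (λ m j → ℕ-con 1 ℕ-:+ ℕ-con 2 ℕ-:* (ℕ-con 1 ℕ-:+ m) ℕ-:+ j
    ℕ-:= ℕ-con 2 ℕ-:+ ℕ-con 2 ℕ-:* m ℕ-:+ (ℕ-con 1 ℕ-:+ j)) refl m j

-- The reflection principle: all paths, less those that reach a forbidden level. At the boundary the
-- recursion meets `ballot (suc (suc m)) 0 = 0`, which fits the formula because the two central
-- binomials of an odd row are equal.
ballot-difference : ∀ m j → let N = suc (suc (2 ℕ.* m)) ℕ.+ j in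
  ballot (suc m) (suc j) ℕ.+ N C m ≡ N C suc m
ballot-difference zero j = begin
  ballot 1 (suc j) ℕ.+ 1 ≡⟨ cong (ℕ._+ 1) (ballot-one (suc j)) ⟩
  suc j ℕ.+ 1            ≡⟨ ℕ.+-comm (suc j) 1 ⟩
  suc (suc j)            ≡⟨ nC1≡n (suc (suc j)) ⟨
  suc (suc j) C 1        ∎
  where open ≡.≡-Reasoning
ballot-difference (suc m) zero    = ballot-difference-step m 0
  (≡.subst (λ k → suc k C suc m ≡ suc k C suc (suc m)) (sym (ℕ.+-identityʳ (2 ℕ.* suc m)))
      (sym (central-symmetry (suc m))))
  (ballot-difference m 1)
ballot-difference (suc m) (suc j) = ballot-difference-step m (suc j)
  (≡.subst (λ k → ballot (suc (suc m)) (suc j) ℕ.+ suc k C suc m ≡ suc k C suc (suc m))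
    (sym (ℕ.+-suc (2 ℕ.* suc m) j)) (ballot-difference (suc m) j))
  (ballot-difference m (suc (suc j)))

-- With x = C(N + 1, m + 1), multiplying the reflection formula by N + 1 turns its two binomials
-- into (N - m) x and (m + 1) x, whose difference is (j + 1) x.
ballot-ratio : ∀ m j → (2 ℕ.* m ℕ.+ j) ℕ.* ballot m j ≡ j ℕ.* ((2 ℕ.* m ℕ.+ j) C m)
ballot-ratio zero    j       = refl
ballot-ratio (suc m) zero    = ℕ.*-zeroʳ (2 ℕ.* suc m ℕ.+ 0)
ballot-ratio (suc m) (suc j) = ≡.subst (λ n → n ℕ.* b ≡ suc j ℕ.* (n C suc m)) sucN≡
  -- One copy of `suc m * x` is added for each of the two binomials, so that no difference is formed
  -- in ℕ.
  (ℕ.+-cancelʳ-≡ (suc m ℕ.* x ℕ.+ suc m ℕ.* x) _ _ (begin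
    suc N ℕ.* b ℕ.+ (suc m ℕ.* x ℕ.+ suc m ℕ.* x)
      ≡⟨ cong (λ y → suc N ℕ.* b ℕ.+ (y ℕ.+ suc m ℕ.* x)) ([1+k]*[1+n]C[1+k]≡[1+n]*nCk N m) ⟩
    suc N ℕ.* b ℕ.+ (suc N ℕ.* (N C m) ℕ.+ suc m ℕ.* x)
      ≡⟨ ℕ.+-assoc (suc N ℕ.* b) _ _ ⟨
    suc N ℕ.* b ℕ.+ suc N ℕ.* (N C m) ℕ.+ suc m ℕ.* x
      ≡⟨ cong (ℕ._+ suc m ℕ.* x) (ℕ.*-distribˡ-+ (suc N) b (N C m)) ⟨
    suc N ℕ.* (b ℕ.+ N C m) ℕ.+ suc m ℕ.* x
      ≡⟨ cong (λ y → suc N ℕ.* y ℕ.+ suc m ℕ.* x) (ballot-difference m j) ⟩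
    suc N ℕ.* (N C suc m) ℕ.+ suc m ℕ.* x
      ≡⟨ [1+n]*nCk+k*[1+n]Ck≡[1+n]*[1+n]Ck N (suc m) ⟩
    suc N ℕ.* x
      ≡⟨ ℕ-solve 3 (λ m j x → (ℕ-con 3 ℕ-:+ (ℕ-con 2 ℕ-:* m) ℕ-:+ j) ℕ-:* x
           ℕ-:= (ℕ-con 1 ℕ-:+ j) ℕ-:* x ℕ-:+ ((ℕ-con 1 ℕ-:+ m) ℕ-:* x ℕ-:+ (ℕ-con 1 ℕ-:+ m) ℕ-:* x))
               refl m j x ⟩
    suc j ℕ.* x ℕ.+ (suc m ℕ.* x ℕ.+ suc m ℕ.* x) ∎))
  where
  open ≡.≡-Reasoning
  b N x : ℕ
  b = ballot (suc m) (suc j)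
  N = suc (suc (2 ℕ.* m)) ℕ.+ j
  x = suc N C suc m

  sucN≡ : suc N ≡ 2 ℕ.* suc m ℕ.+ suc j
  sucN≡ = ℕ-solve 2 (λ m j → ℕ-con 3 ℕ-:+ ℕ-con 2 ℕ-:* m ℕ-:+ j
    ℕ-:= ℕ-con 2 ℕ-:* (ℕ-con 1 ℕ-:+ m) ℕ-:+ (ℕ-con 1 ℕ-:+ j)) refl m j

-- At `j = 1` the ratio formula reads (2n + 1) b = C(2n + 1, n), while (2n + 1) C(2n, n) = (n + 1)
-- C(2n + 1, n); the common factor 2n + 1 is cancelled.
ballot-catalan : ∀ n → suc n ℕ.* ballot n 1 ≡ (2 ℕ.* n) C n
ballot-catalan n = ℕ.*-cancelˡ-≡ _ _ (suc N) (ℕ.+-cancelʳ-≡ (n ℕ.* x) _ _ (begin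
  suc N ℕ.* (suc n ℕ.* b) ℕ.+ n ℕ.* x
    ≡⟨ ℕ-solve 4 (λ n a b x → a ℕ-:* ((ℕ-con 1 ℕ-:+ n) ℕ-:* b) ℕ-:+ n ℕ-:* x
         ℕ-:= (ℕ-con 1 ℕ-:+ n) ℕ-:* (a ℕ-:* b) ℕ-:+ n ℕ-:* x) refl n (suc N) b x ⟩
  suc n ℕ.* (suc N ℕ.* b) ℕ.+ n ℕ.* x
    ≡⟨ cong (λ y → suc n ℕ.* y ℕ.+ n ℕ.* x) [1+N]*b≡x ⟩
  suc n ℕ.* x ℕ.+ n ℕ.* x
    ≡⟨ ℕ-solve 2 (λ n x → (ℕ-con 1 ℕ-:+ n) ℕ-:* x ℕ-:+ n ℕ-:* x ℕ-:= (ℕ-con 1 ℕ-:+ ℕ-con 2 ℕ-:* n) ℕ-:*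
         x) refl n x ⟩
  suc N ℕ.* x
    ≡⟨ [1+n]*nCk+k*[1+n]Ck≡[1+n]*[1+n]Ck N n ⟨
  suc N ℕ.* (N C n) ℕ.+ n ℕ.* x ∎))
  where
  open ≡.≡-Reasoning
  b N x : ℕ
  b = ballot n 1
  N = 2 ℕ.* n
  x = suc N C n

  [1+N]*b≡x : suc N ℕ.* b ≡ x
  [1+N]*b≡x = trans (≡.subst (λ k → k ℕ.* b ≡ 1 ℕ.* (k C n)) (ℕ.+-comm N 1) (ballot-ratio n 1))
      (ℕ.*-identityˡ x)

-- Natural numbers and denominators in ℚ.

fromℕ-+ : ∀ m n → fromℕ (m ℕ.+ n) ≡ fromℕ m ℚ.+ fromℕ n
fromℕ-+ m n = ℚ.toℚᵘ-injective (begin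
  ℚ.toℚᵘ (fromℕ (m ℕ.+ n))                ≈⟨ ℚ.toℚᵘ-fromℚᵘ (mkℚᵘ (+ (m ℕ.+ n)) 0) ⟩
  mkℚᵘ (+ (m ℕ.+ n)) 0
    ≈⟨ *≡* (ℤ-Solver.solve 2 (λ x y →
      (x :+ y) :* con (+ 1) := (x :* con (+ 1) :+ y :* con (+ 1)) :* con (+ 1)) refl (+ m) (+ n)) ⟩
  mkℚᵘ (+ m) 0 ℚᵘ.+ mkℚᵘ (+ n) 0
    ≈⟨ ℚᵘ.+-cong (ℚ.toℚᵘ-fromℚᵘ (mkℚᵘ (+ m) 0)) (ℚ.toℚᵘ-fromℚᵘ (mkℚᵘ (+ n) 0)) ⟨
  ℚ.toℚᵘ (fromℕ m) ℚᵘ.+ ℚ.toℚᵘ (fromℕ n)  ≈⟨ ℚ.toℚᵘ-homo-+ (fromℕ m) (fromℕ n) ⟨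
  ℚ.toℚᵘ (fromℕ m ℚ.+ fromℕ n)            ∎)
  where
  open ℚᵘ.≃-Reasoning
  open ℤ-Solver

/-*-fromℕ : ∀ a d → (+ a ℚ./ suc d) ℚ.* fromℕ (suc d) ≡ fromℕ a
/-*-fromℕ a d = ℚ.toℚᵘ-injective (begin
  ℚ.toℚᵘ ((+ a ℚ./ suc d) ℚ.* fromℕ (suc d))            ≈⟨ ℚ.toℚᵘ-homo-* (+ a ℚ./ suc d) (fromℕ (suc d)) ⟩
  ℚ.toℚᵘ (+ a ℚ./ suc d) ℚᵘ.* ℚ.toℚᵘ (fromℕ (suc d))
    ≈⟨ ℚᵘ.*-cong (ℚ.toℚᵘ-fromℚᵘ (mkℚᵘ (+ a) d)) (ℚ.toℚᵘ-fromℚᵘ (mkℚᵘ (+ suc d) 0)) ⟩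
  mkℚᵘ (+ a) d ℚᵘ.* mkℚᵘ (+ suc d) 0                    ≈⟨ *≡* (ℤ.*-assoc (+ a) (+ suc d) (+ 1)) ⟩
  mkℚᵘ (+ a ) 0                                         ≈⟨ ℚ.toℚᵘ-fromℚᵘ (mkℚᵘ (+ a) 0) ⟨
  ℚ.toℚᵘ (fromℕ a)                                      ∎)
  where open ℚᵘ.≃-Reasoning

fromℕ-* : ∀ m n → fromℕ (m ℕ.* n) ≡ fromℕ m ℚ.* fromℕ n
fromℕ-* zero    n = sym (ℚ.*-zeroˡ (fromℕ n))
fromℕ-* (suc m) n = begin
  fromℕ (n ℕ.+ m ℕ.* n)              ≡⟨ fromℕ-+ n (m ℕ.* n) ⟩
  fromℕ n ℚ.+ fromℕ (m ℕ.* n)        ≡⟨ cong (fromℕ n ℚ.+_) (fromℕ-* m n) ⟩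
  fromℕ n ℚ.+ fromℕ m ℚ.* fromℕ n
    ≡⟨ solve 2 (λ x y → y :+ x :* y := (con 1ℚ :+ x) :* y) refl (fromℕ m) (fromℕ n) ⟩
  (1ℚ ℚ.+ fromℕ m) ℚ.* fromℕ n       ≡⟨ cong (ℚ._* fromℕ n) (fromℕ-+ 1 m) ⟨
  fromℕ (suc m) ℚ.* fromℕ n          ∎
  where
  open ≡.≡-Reasoning
  open ℚ-Solver

/-*-solve : ∀ a d {x y} → fromℕ (suc d) ℚ.* x ≡ fromℕ a ℚ.* y → (+ a ℚ./ suc d) ℚ.* y ≡ x
/-*-solve a d {x} {y} dx≡ay = begin
  r ℚ.* y                      ≡⟨ ℚ.*-identityˡ (r ℚ.* y) ⟨
  1ℚ ℚ.* (r ℚ.* y)             ≡⟨ cong (ℚ._* (r ℚ.* y)) (/-*-fromℕ 1 d) ⟨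
  e ℚ.* D ℚ.* (r ℚ.* y)
    ≡⟨ solve 4 (λ e D r y → e :* D :* (r :* y) := e :* ((r :* D) :* y)) refl e D r y ⟩
  e ℚ.* ((r ℚ.* D) ℚ.* y)      ≡⟨ cong (λ z → e ℚ.* (z ℚ.* y)) (/-*-fromℕ a d) ⟩
  e ℚ.* (fromℕ a ℚ.* y)        ≡⟨ cong (e ℚ.*_) dx≡ay ⟨
  e ℚ.* (D ℚ.* x)              ≡⟨ ℚ.*-assoc e D x ⟨
  e ℚ.* D ℚ.* x                ≡⟨ cong (ℚ._* x) (/-*-fromℕ 1 d) ⟩
  1ℚ ℚ.* x                     ≡⟨ ℚ.*-identityˡ x ⟩
  x                            ∎
  where
  open ≡.≡-Reasoning
  open ℚ-Solver
  r e D : ℚ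
  r = + a ℚ./ suc d
  e = + 1 ℚ./ suc d
  D = fromℕ (suc d)

/-*-fromℕ-solve : ∀ a d x y → suc d ℕ.* x ≡ a ℕ.* y → (+ a ℚ./ suc d) ℚ.* fromℕ y ≡ fromℕ x
/-*-fromℕ-solve a d x y dx≡ay = /-*-solve a d
  (trans (sym (fromℕ-* (suc d) x)) (trans (cong fromℕ dx≡ay) (fromℕ-* a y)))

catalan≡ballot : ∀ n → catalan n ≡ fromℕ (ballot n 1)
catalan≡ballot n = /-*-fromℕ-solve 1 n (ballot n 1) ((2 ℕ.* n) C n)
  (trans (ballot-catalan n) (sym (ℕ.*-identityˡ _)))

-- Narayana numbers as determinants.

binom : ℕ → ℕ → ℚ
binom n k = fromℕ (n C k)

binom-pascal : ∀ n k → binom (suc n) (suc k) ≡ binom n k ℚ.+ binom n (suc k)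
binom-pascal n k = trans (cong fromℕ (pascal n k)) (fromℕ-+ (n C k) (n C suc k))

-- Since (m + 1) C(m, i) = (m + 1 - i) X and (m + 1) C(m, i + 1) = (m - i) Y, the determinant times
-- m + 1 is X Y. The denominator disappears, which leaves a form open to Pascal's rule.
narayana-difference : ∀ m i → (+ 1 ℚ./ suc m) ℚ.* binom (suc m) i ℚ.* binom (suc m) (suc i)
  ≡ binom m i ℚ.* binom (suc m) (suc i) ℚ.- binom m (suc i) ℚ.* binom (suc m) i
narayana-difference m i = begin
  (+ 1 ℚ./ suc m) ℚ.* fromℕ X ℚ.* fromℕ Y
    ≡⟨ ℚ.*-assoc (+ 1 ℚ./ suc m) (fromℕ X) (fromℕ Y) ⟩
  (+ 1 ℚ./ suc m) ℚ.* (fromℕ X ℚ.* fromℕ Y)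
    ≡⟨ /-*-solve 1 m scaled ⟩
  fromℕ c ℚ.* fromℕ Y ℚ.- fromℕ c′ ℚ.* fromℕ X ∎
  where
  open ≡.≡-Reasoning
  X Y c c′ : ℕ
  X  = suc m C i
  Y  = suc m C suc i
  c  = m C i
  c′ = m C suc i

  natural : suc m ℕ.* (c ℕ.* Y) ≡ X ℕ.* Y ℕ.+ suc m ℕ.* (c′ ℕ.* X)
  -- Adding `i * X * Y` lets both ratio relations be used in their additive form.
  natural = ℕ.+-cancelʳ-≡ (i ℕ.* X ℕ.* Y) _ _ (begin
    suc m ℕ.* (c ℕ.* Y) ℕ.+ i ℕ.* X ℕ.* Y
      ≡⟨ ℕ-solve 5 (λ M c i X Y →
           M ℕ-:* (c ℕ-:* Y) ℕ-:+ i ℕ-:* X ℕ-:* Y ℕ-:= (M ℕ-:* c ℕ-:+ i ℕ-:* X) ℕ-:* Y) refl (suc m) c i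
           X Y ⟩
    (suc m ℕ.* c ℕ.+ i ℕ.* X) ℕ.* Y
      ≡⟨ cong (ℕ._* Y) ([1+n]*nCk+k*[1+n]Ck≡[1+n]*[1+n]Ck m i) ⟩
    suc m ℕ.* X ℕ.* Y
      ≡⟨ ℕ-solve 3 (λ M X Y → M ℕ-:* X ℕ-:* Y ℕ-:= M ℕ-:* Y ℕ-:* X) refl (suc m) X Y ⟩
    suc m ℕ.* Y ℕ.* X
      ≡⟨ cong (ℕ._* X) ([1+n]*nCk+k*[1+n]Ck≡[1+n]*[1+n]Ck m (suc i)) ⟨
    (suc m ℕ.* c′ ℕ.+ suc i ℕ.* Y) ℕ.* X
      ≡⟨ ℕ-solve 5 (λ M c i X Y → (M ℕ-:* c ℕ-:+ (ℕ-con 1 ℕ-:+ i) ℕ-:* Y) ℕ-:* X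
           ℕ-:= (X ℕ-:* Y ℕ-:+ M ℕ-:* (c ℕ-:* X)) ℕ-:+ i ℕ-:* X ℕ-:* Y) refl (suc m) c′ i X Y ⟩
    (X ℕ.* Y ℕ.+ suc m ℕ.* (c′ ℕ.* X)) ℕ.+ i ℕ.* X ℕ.* Y ∎)

  natural-ℚ : fromℕ (suc m) ℚ.* (fromℕ c ℚ.* fromℕ Y)
      ≡ fromℕ X ℚ.* fromℕ Y ℚ.+ fromℕ (suc m) ℚ.* (fromℕ c′ ℚ.* fromℕ X)
  natural-ℚ = begin
    fromℕ (suc m) ℚ.* (fromℕ c ℚ.* fromℕ Y)    ≡⟨ cong (fromℕ (suc m) ℚ.*_) (fromℕ-* c Y) ⟨
    fromℕ (suc m) ℚ.* fromℕ (c ℕ.* Y)          ≡⟨ fromℕ-* (suc m) (c ℕ.* Y) ⟨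
    fromℕ (suc m ℕ.* (c ℕ.* Y))                ≡⟨ cong fromℕ natural ⟩
    fromℕ (X ℕ.* Y ℕ.+ suc m ℕ.* (c′ ℕ.* X))   ≡⟨ fromℕ-+ (X ℕ.* Y) _ ⟩
    fromℕ (X ℕ.* Y) ℚ.+ fromℕ (suc m ℕ.* (c′ ℕ.* X))
      ≡⟨ cong₂ ℚ._+_ (fromℕ-* X Y)
           (trans (fromℕ-* (suc m) (c′ ℕ.* X)) (cong (fromℕ (suc m) ℚ.*_) (fromℕ-* c′ X))) ⟩
    fromℕ X ℚ.* fromℕ Y ℚ.+ fromℕ (suc m) ℚ.* (fromℕ c′ ℚ.* fromℕ X) ∎

  scaled : fromℕ (suc m) ℚ.* (fromℕ c ℚ.* fromℕ Y ℚ.- fromℕ c′ ℚ.* fromℕ X) ≡ 1ℚ ℚ.* (fromℕ X ℚ.* fromℕ Y)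
  scaled = begin
    fromℕ (suc m) ℚ.* (fromℕ c ℚ.* fromℕ Y ℚ.- fromℕ c′ ℚ.* fromℕ X)
      ≡⟨ solve 3 (λ M u v → M :* (u :- v) := M :* u :- M :* v) refl (fromℕ (suc m))
           (fromℕ c ℚ.* fromℕ Y) (fromℕ c′ ℚ.* fromℕ X) ⟩
    fromℕ (suc m) ℚ.* (fromℕ c ℚ.* fromℕ Y) ℚ.- fromℕ (suc m) ℚ.* (fromℕ c′ ℚ.* fromℕ X)
      ≡⟨ cong (ℚ._- fromℕ (suc m) ℚ.* (fromℕ c′ ℚ.* fromℕ X)) natural-ℚ ⟩
    fromℕ X ℚ.* fromℕ Y ℚ.+ fromℕ (suc m) ℚ.* (fromℕ c′ ℚ.* fromℕ X) ℚ.- fromℕ (suc m) ℚ.*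
        (fromℕ c′ ℚ.* fromℕ X)
      ≡⟨ solve 2 (λ u v → u :+ v :- v := con 1ℚ :* u) refl (fromℕ X ℚ.* fromℕ Y) _ ⟩
    1ℚ ℚ.* (fromℕ X ℚ.* fromℕ Y) ∎
    where open ℚ-Solver

-- Convolution and the ring of polynomials.

-- Cauchy product of coefficient sequences.
conv : (ℕ → ℚ) → (ℕ → ℚ) → ℕ → ℚ
conv f g zero    = f 0 ℚ.* g 0
conv f g (suc n) = f 0 ℚ.* g (suc n) ℚ.+ conv (f ∘ suc) g n

module Convolution where
  open ≡.≡-Reasoning
  open ℚ-Solver

  conv-cong : ∀ {f f′ g g′} → (∀ i → f i ≡ f′ i) → (∀ i → g i ≡ g′ i) → ∀ n → conv f g n ≡ conv f′ g′ n
  conv-cong f≗f′ g≗g′ zero    = cong₂ ℚ._*_ (f≗f′ 0) (g≗g′ 0)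
  conv-cong f≗f′ g≗g′ (suc n) =
    cong₂ ℚ._+_ (cong₂ ℚ._*_ (f≗f′ 0) (g≗g′ (suc n))) (conv-cong (f≗f′ ∘ suc) g≗g′ n)

  conv-zeroˡ : ∀ g n → conv (λ _ → 0ℚ) g n ≡ 0ℚ
  conv-zeroˡ g zero    = ℚ.*-zeroˡ (g 0)
  conv-zeroˡ g (suc n) = trans (cong₂ ℚ._+_ (ℚ.*-zeroˡ (g (suc n))) (conv-zeroˡ g n)) refl

  -- `conv` recurses on its first factor; commutativity needs the matching recursion on the second.
  conv-sucʳ : ∀ f g n → conv f g (suc n) ≡ conv f (g ∘ suc) n ℚ.+ f (suc n) ℚ.* g 0
  conv-sucʳ f g zero    = refl
  conv-sucʳ f g (suc n) = trans (cong (f 0 ℚ.* g (suc (suc n)) ℚ.+_) (conv-sucʳ (f ∘ suc) g n))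
      (sym (ℚ.+-assoc (f 0 ℚ.* g (suc (suc n))) _ _))

  conv-comm : ∀ f g n → conv f g n ≡ conv g f n
  conv-comm f g zero    = ℚ.*-comm (f 0) (g 0)
  conv-comm f g (suc n) = begin
    f 0 ℚ.* g (suc n) ℚ.+ conv (f ∘ suc) g n  ≡⟨ cong₂ ℚ._+_ (ℚ.*-comm (f 0) _) (conv-comm (f ∘ suc) g n) ⟩
    g (suc n) ℚ.* f 0 ℚ.+ conv g (f ∘ suc) n  ≡⟨ ℚ.+-comm (g (suc n) ℚ.* f 0) _ ⟩
    conv g (f ∘ suc) n ℚ.+ g (suc n) ℚ.* f 0  ≡⟨ conv-sucʳ g f n ⟨
    conv g f (suc n)                          ∎

  conv-distribʳ-+ : ∀ f g h n → conv (λ i → f i ℚ.+ g i) h n ≡ conv f h n ℚ.+ conv g h n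
  conv-distribʳ-+ f g h zero    = ℚ.*-distribʳ-+ (h 0) (f 0) (g 0)
  conv-distribʳ-+ f g h (suc n) = begin
    (f 0 ℚ.+ g 0) ℚ.* h (suc n) ℚ.+ conv (λ i → f (suc i) ℚ.+ g (suc i)) h n
      ≡⟨ cong ((f 0 ℚ.+ g 0) ℚ.* h (suc n) ℚ.+_) (conv-distribʳ-+ (f ∘ suc) (g ∘ suc) h n) ⟩
    (f 0 ℚ.+ g 0) ℚ.* h (suc n) ℚ.+ (conv (f ∘ suc) h n ℚ.+ conv (g ∘ suc) h n)
      ≡⟨ solve 5 (λ a b c u v → (a :+ b) :* c :+ (u :+ v) := (a :* c :+ u) :+ (b :* c :+ v)) refl (f 0)
           (g 0) (h (suc n)) _ _ ⟩
    conv f h (suc n) ℚ.+ conv g h (suc n) ∎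

  conv-*ˡ : ∀ a f g n → conv (λ i → a ℚ.* f i) g n ≡ a ℚ.* conv f g n
  conv-*ˡ a f g zero    = ℚ.*-assoc a (f 0) (g 0)
  conv-*ˡ a f g (suc n) = begin
    a ℚ.* f 0 ℚ.* g (suc n) ℚ.+ conv (λ i → a ℚ.* f (suc i)) g n
      ≡⟨ cong (a ℚ.* f 0 ℚ.* g (suc n) ℚ.+_) (conv-*ˡ a (f ∘ suc) g n) ⟩
    a ℚ.* f 0 ℚ.* g (suc n) ℚ.+ a ℚ.* conv (f ∘ suc) g n
      ≡⟨ solve 4 (λ a b c u → a :* b :* c :+ a :* u := a :* (b :* c :+ u)) refl a (f 0) (g (suc n)) _ ⟩
    a ℚ.* conv f g (suc n) ∎

  conv-assoc : ∀ f g h n → conv (conv f g) h n ≡ conv f (conv g h) n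
  conv-assoc f g h zero    = ℚ.*-assoc (f 0) (g 0) (h 0)
  conv-assoc f g h (suc n) = begin
    f 0 ℚ.* g 0 ℚ.* h (suc n) ℚ.+ conv (λ i → f 0 ℚ.* g (suc i) ℚ.+ conv (f ∘ suc) g i) h n
      ≡⟨ cong (f 0 ℚ.* g 0 ℚ.* h (suc n) ℚ.+_) (trans (conv-distribʳ-+ (λ i → f 0 ℚ.* g (suc i)) _ h n)
           (cong₂ ℚ._+_ (conv-*ˡ (f 0) (g ∘ suc) h n) (conv-assoc (f ∘ suc) g h n))) ⟩
    f 0 ℚ.* g 0 ℚ.* h (suc n) ℚ.+ (f 0 ℚ.* conv (g ∘ suc) h n ℚ.+ conv (f ∘ suc) (conv g h) n)
      ≡⟨ solve 5 (λ a b c u v → a :* b :* c :+ (a :* u :+ v) := a :* (b :* c :+ u) :+ v) refl (f 0)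
           (g 0) (h (suc n)) _ _ ⟩
    conv f (conv g h) (suc n) ∎

open Convolution

coeff-+ : ∀ p r i → coeff (p + r) i ≡ coeff p i ℚ.+ coeff r i
coeff-+ []      r       i       = sym (ℚ.+-identityˡ (coeff r i))
coeff-+ (a ∷ p) []      i       = sym (ℚ.+-identityʳ (coeff (a ∷ p) i))
coeff-+ (a ∷ p) (b ∷ r) zero    = refl
coeff-+ (a ∷ p) (b ∷ r) (suc i) = coeff-+ p r i

coeff-neg : ∀ p i → coeff (- p) i ≡ ℚ.- coeff p i
coeff-neg []      i       = refl
coeff-neg (a ∷ p) zero    = refl
coeff-neg (a ∷ p) (suc i) = coeff-neg p i

coeff-scale : ∀ a p i → coeff (map (a ℚ.*_) p) i ≡ a ℚ.* coeff p i
coeff-scale a []      i       = sym (ℚ.*-zeroʳ a)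
coeff-scale a (b ∷ p) zero    = refl
coeff-scale a (b ∷ p) (suc i) = coeff-scale a p i

-- `mulPoly` and `conv` follow the same recursion. The ring laws can thus be proved for coefficient
-- sequences, where lists differing by trailing zeros coincide.
coeff-* : ∀ p r i → coeff (p * r) i ≡ conv (coeff p) (coeff r) i
coeff-* []      r i       = sym (conv-zeroˡ (coeff r) i)
coeff-* (a ∷ p) r zero    = trans (coeff-+ (map (a ℚ.*_) r) (0ℚ ∷ p * r) 0)
  (trans (cong (ℚ._+ 0ℚ) (coeff-scale a r 0)) (ℚ.+-identityʳ _))
coeff-* (a ∷ p) r (suc i) = trans (coeff-+ (map (a ℚ.*_) r) (0ℚ ∷ p * r) (suc i))
  (cong₂ ℚ._+_ (coeff-scale a r (suc i)) (coeff-* p r i))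

coeff-const* : ∀ a p i → coeff (const a * p) i ≡ a ℚ.* coeff p i
coeff-const* a p i = begin
  coeff (map (a ℚ.*_) p + (0ℚ ∷ [])) i             ≡⟨ coeff-+ (map (a ℚ.*_) p) (0ℚ ∷ []) i ⟩
  coeff (map (a ℚ.*_) p) i ℚ.+ coeff (0ℚ ∷ []) i   ≡⟨ cong₂ ℚ._+_ (coeff-scale a p i) (zeros i) ⟩
  a ℚ.* coeff p i ℚ.+ 0ℚ                           ≡⟨ ℚ.+-identityʳ (a ℚ.* coeff p i) ⟩
  a ℚ.* coeff p i                                  ∎
  where
  open ≡.≡-Reasoning
  zeros : ∀ i → coeff (0ℚ ∷ []) i ≡ 0ℚ
  zeros zero    = refl
  zeros (suc i) = refl

polyRing : CommutativeRing 0ℓ 0ℓ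
polyRing = record
  { Carrier = Poly
  ; _≈_ = _≈_
  ; _+_ = _+_
  ; _*_ = _*_
  ; -_ = -_
  ; 0# = 0#
  ; 1# = 1#
  ; isCommutativeRing = record
    { isRing = record
      { +-isAbelianGroup = record
        { isGroup = record
          { isMonoid = record
            { isSemigroup = record
              { isMagma = record
                { isEquivalence = record
                  { refl  = λ i → refl
                  ; sym   = λ p≈r i → sym (p≈r i)
                  ; trans = λ p≈r r≈s i → trans (p≈r i) (r≈s i)
                  }
                ; ∙-cong = λ {p} {p′} {r} {r′} p≈p′ r≈r′ i →
                    trans (coeff-+ p r i) (trans (cong₂ ℚ._+_ (p≈p′ i) (r≈r′ i)) (sym (coeff-+ p′ r′ i)))
                }
              ; assoc = +-assoc
              }
            ; identity = (λ p i → refl) , (λ p i → trans (coeff-+ p 0# i) (ℚ.+-identityʳ _))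
            }
          ; inverse =
              (λ p i → trans (coeff-+ (- p) p i)
                  (trans (cong (ℚ._+ coeff p i) (coeff-neg p i)) (ℚ.+-inverseˡ (coeff p i))))
            , (λ p i → trans (coeff-+ p (- p) i)
                (trans (cong (coeff p i ℚ.+_) (coeff-neg p i)) (ℚ.+-inverseʳ (coeff p i))))
          ; ⁻¹-cong = λ {p} {r} p≈r i →
              trans (coeff-neg p i) (trans (cong ℚ.-_ (p≈r i)) (sym (coeff-neg r i)))
          }
        ; comm = λ p r i → trans (coeff-+ p r i) (trans (ℚ.+-comm (coeff p i) _) (sym (coeff-+ r p i)))
        }
      ; *-cong = λ {p} {p′} {r} {r′} p≈p′ r≈r′ i →
          trans (coeff-* p r i) (trans (conv-cong p≈p′ r≈r′ i) (sym (coeff-* p′ r′ i)))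
      ; *-assoc = *-assoc
      ; *-identity = *-identityˡ , (λ p i → trans (*-comm p 1# i) (*-identityˡ p i))
      ; distrib =
          (λ s p r i → trans (*-comm s (p + r) i)
              (trans (*-distribʳ-+ s p r i) (trans (coeff-+ (p * s) (r * s) i)
            (trans (cong₂ ℚ._+_ (*-comm p s i) (*-comm r s i)) (sym (coeff-+ (s * p) (s * r) i))))))
        , *-distribʳ-+
      }
    ; *-comm = *-comm
    }
  }
  where
  +-assoc : ∀ p r s → (p + r) + s ≈ p + (r + s)
  +-assoc p r s i = begin
    coeff ((p + r) + s) i
      ≡⟨ trans (coeff-+ (p + r) s i) (cong (ℚ._+ coeff s i) (coeff-+ p r i)) ⟩
    coeff p i ℚ.+ coeff r i ℚ.+ coeff s i          ≡⟨ ℚ.+-assoc (coeff p i) _ _ ⟩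
    coeff p i ℚ.+ (coeff r i ℚ.+ coeff s i)
      ≡⟨ trans (coeff-+ p (r + s) i) (cong (coeff p i ℚ.+_) (coeff-+ r s i)) ⟨
    coeff (p + (r + s)) i                          ∎
    where open ≡.≡-Reasoning

  *-assoc : ∀ p r s → (p * r) * s ≈ p * (r * s)
  *-assoc p r s i = begin
    coeff ((p * r) * s) i
      ≡⟨ trans (coeff-* (p * r) s i) (conv-cong (coeff-* p r) (λ _ → refl) i) ⟩
    conv (conv (coeff p) (coeff r)) (coeff s) i ≡⟨ conv-assoc (coeff p) (coeff r) (coeff s) i ⟩
    conv (coeff p) (conv (coeff r) (coeff s))
        i ≡⟨ trans (coeff-* p (r * s) i) (conv-cong {coeff p} (λ _ → refl) (coeff-* r s) i) ⟨
    coeff (p * (r * s)) i                      ∎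
    where open ≡.≡-Reasoning

  *-comm : ∀ p r → p * r ≈ r * p
  *-comm p r i = trans (coeff-* p r i) (trans (conv-comm (coeff p) (coeff r) i) (sym (coeff-* r p i)))

  *-identityˡ : ∀ p → 1# * p ≈ p
  *-identityˡ p i = trans (coeff-const* 1ℚ p i) (ℚ.*-identityˡ (coeff p i))

  *-distribʳ-+ : ∀ s p r → (p + r) * s ≈ p * s + r * s
  *-distribʳ-+ s p r i = begin
    coeff ((p + r) * s) i
      ≡⟨ trans (coeff-* (p + r) s i) (conv-cong {g = coeff s} (coeff-+ p r) (λ _ → refl) i) ⟩
    conv (λ j → coeff p j ℚ.+ coeff r j) (coeff s) i ≡⟨ conv-distribʳ-+ (coeff p) (coeff r) (coeff s) i ⟩
    conv (coeff p) (coeff s) i ℚ.+ conv (coeff r) (coeff s)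
        i ≡⟨ cong₂ ℚ._+_ (coeff-* p s i) (coeff-* r s i) ⟨
    coeff (p * s) i ℚ.+ coeff (r * s) i          ≡⟨ coeff-+ (p * s) (r * s) i ⟨
    coeff (p * s + r * s) i                      ∎
    where open ≡.≡-Reasoning

private
  module Poly = CommutativeRing polyRing

open RingIdentities polyRing

-- Coefficients of products with q, 1 + q and 1 - q, and of the Narayana polynomials.

coeff-q*-zero : ∀ p → coeff (q * p) 0 ≡ 0ℚ
coeff-q*-zero p = trans (coeff-* q p 0) (ℚ.*-zeroˡ (coeff p 0))

coeff-q*-suc : ∀ p i → coeff (q * p) (suc i) ≡ coeff p i
coeff-q*-suc p i = trans (coeff-* q p (suc i))
  (trans (cong₂ ℚ._+_ (ℚ.*-zeroˡ (coeff p (suc i))) (trans (sym (coeff-* 1# p i)) (Poly.*-identityˡ p i)))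
    (ℚ.+-identityˡ (coeff p i)))

q*p≈0∷p : ∀ p → q * p ≈ (0ℚ ∷ p)
q*p≈0∷p p zero    = coeff-q*-zero p
q*p≈0∷p p (suc i) = coeff-q*-suc p i

[1+q]*p≈p+q*p : ∀ p → (1# + q) * p ≈ p + q * p
[1+q]*p≈p+q*p p i = sym (x+r*x≈[1+r]*x q p i)

coeff-[1+q]*-zero : ∀ p → coeff ((1# + q) * p) 0 ≡ coeff p 0
coeff-[1+q]*-zero p = trans ([1+q]*p≈p+q*p p 0) (trans (coeff-+ p (q * p) 0)
  (trans (cong (coeff p 0 ℚ.+_) (coeff-q*-zero p)) (ℚ.+-identityʳ _)))

coeff-[1+q]*-suc : ∀ p i → coeff ((1# + q) * p) (suc i) ≡ coeff p (suc i) ℚ.+ coeff p i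
coeff-[1+q]*-suc p i = trans ([1+q]*p≈p+q*p p (suc i)) (trans (coeff-+ p (q * p) (suc i))
  (cong (coeff p (suc i) ℚ.+_) (coeff-q*-suc p i)))

coeff-[1-q]*-zero : ∀ p → coeff ((1# - q) * p) 0 ≡ coeff p 0
coeff-[1-q]*-zero p = trans (coeff-* (1# - q) p 0) (ℚ.*-identityˡ (coeff p 0))

coeff-[1-q]*-suc : ∀ p i → coeff ((1# - q) * p) (suc i) ≡ coeff p (suc i) ℚ.- coeff p i
coeff-[1-q]*-suc p i = begin
  coeff ((1# - q) * p) (suc i)                 ≡⟨ coeff-* (1# - q) p (suc i) ⟩
  1ℚ ℚ.* coeff p (suc i) ℚ.+ conv (coeff (const (ℚ.- 1ℚ))) (coeff p) i
    ≡⟨ cong₂ ℚ._+_ (ℚ.*-identityˡ (coeff p (suc i)))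
         (trans (sym (coeff-* (const (ℚ.- 1ℚ)) p i)) (coeff-const* (ℚ.- 1ℚ) p i)) ⟩
  coeff p (suc i) ℚ.+ (ℚ.- 1ℚ) ℚ.* coeff p i
    ≡⟨ solve 2 (λ u v → u :+ con (ℚ.- 1ℚ) :* v := u :- v) refl (coeff p (suc i)) (coeff p i) ⟩
  coeff p (suc i) ℚ.- coeff p i                ∎
  where
  open ≡.≡-Reasoning
  open ℚ-Solver

coeff-∑<-cong : ∀ n (f g : ℕ → Poly) {i j} → (∀ k → coeff (f k) i ≡ coeff (g k) j) → coeff (∑< n f) i
  ≡ coeff (∑< n g) j
coeff-∑<-cong zero    f g f≡g = refl
coeff-∑<-cong (suc n) f g {i} {j} f≡g = begin
  coeff (f 0 + ∑< n (f ∘ suc)) i                ≡⟨ coeff-+ (f 0) _ i ⟩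
  coeff (f 0) i ℚ.+ coeff (∑< n (f ∘ suc)) i
    ≡⟨ cong₂ ℚ._+_ (f≡g 0) (coeff-∑<-cong n (f ∘ suc) (g ∘ suc) (f≡g ∘ suc)) ⟩
  coeff (g 0) j ℚ.+ coeff (∑< n (g ∘ suc)) j    ≡⟨ coeff-+ (g 0) _ j ⟨
  coeff (g 0 + ∑< n (g ∘ suc)) j                ∎
  where open ≡.≡-Reasoning

coeff-∑<-zero : ∀ n (f : ℕ → Poly) {i} → (∀ k → coeff (f k) i ≡ 0ℚ) → coeff (∑< n f) i ≡ 0ℚ
coeff-∑<-zero zero    f f≡0 = refl
coeff-∑<-zero (suc n) f {i} f≡0 =
  trans (coeff-+ (f 0) _ i) (cong₂ ℚ._+_ (f≡0 0) (coeff-∑<-zero n (f ∘ suc) (f≡0 ∘ suc)))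

coeff-monomial-zero : ∀ a j → coeff (const a * q ^ suc j) 0 ≡ 0ℚ
coeff-monomial-zero a j = trans (coeff-const* a (q ^ suc j) 0)
  (trans (cong (a ℚ.*_) (coeff-q*-zero (q ^ j))) (ℚ.*-zeroʳ a))

coeff-monomial-suc : ∀ a j i → coeff (const a * q ^ suc j) (suc i) ≡ coeff (const a * q ^ j) i
coeff-monomial-suc a j i =
  trans (coeff-const* a (q ^ suc j) (suc i))
  (trans (cong (a ℚ.*_) (coeff-q*-suc (q ^ j) i)) (sym (coeff-const* a (q ^ j) i)))

coeff-∑<-monomials : ∀ n (a : ℕ → ℚ) i → (∀ k → n ℕ.≤ k → a k ≡ 0ℚ) →
  coeff (∑< n (λ j → const (a j) * q ^ j)) i ≡ a i
coeff-∑<-monomials zero    a i       a≡0 = sym (a≡0 i z≤n)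
coeff-∑<-monomials (suc n) a zero    a≡0 = begin
  coeff (const (a 0) * 1# + ∑< n (λ j → const (a (suc j)) * q ^ suc j)) 0
    ≡⟨ coeff-+ (const (a 0) * 1#) (∑< n (λ j → const (a (suc j)) * q ^ suc j)) 0 ⟩
  coeff (const (a 0) * 1#) 0 ℚ.+ coeff (∑< n (λ j → const (a (suc j)) * q ^ suc j)) 0
    ≡⟨ cong₂ ℚ._+_ (trans (coeff-const* (a 0) 1# 0) (ℚ.*-identityʳ (a 0)))
         (coeff-∑<-zero n (λ j → const (a (suc j)) * q ^ suc j) λ j → coeff-monomial-zero (a (suc j)) j) ⟩
  a 0 ℚ.+ 0ℚ
    ≡⟨ ℚ.+-identityʳ (a 0) ⟩
  a 0 ∎
  where open ≡.≡-Reasoning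
coeff-∑<-monomials (suc n) a (suc i) a≡0 = begin
  coeff (const (a 0) * 1# + ∑< n (λ j → const (a (suc j)) * q ^ suc j)) (suc i)
    ≡⟨ coeff-+ (const (a 0) * 1#) (∑< n (λ j → const (a (suc j)) * q ^ suc j)) (suc i) ⟩
  coeff (const (a 0) * 1#) (suc i) ℚ.+ coeff (∑< n (λ j → const (a (suc j)) * q ^ suc j)) (suc i)
    ≡⟨ cong₂ ℚ._+_ (trans (coeff-const* (a 0) 1# (suc i)) (ℚ.*-zeroʳ (a 0)))
         (trans (coeff-∑<-cong n (λ j → const (a (suc j)) * q ^ suc j) (λ j → const (a (suc j)) * q ^ j)
             λ j → coeff-monomial-suc (a (suc j)) j i)
             (coeff-∑<-monomials n (a ∘ suc) i λ k n≤k → a≡0 (suc k) (s≤s n≤k))) ⟩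
  0ℚ ℚ.+ a (suc i)
    ≡⟨ ℚ.+-identityˡ (a (suc i)) ⟩
  a (suc i) ∎
  where open ≡.≡-Reasoning

coeff-𝔑-zero : ∀ m → coeff (𝔑 (suc m)) 0 ≡ 0ℚ
coeff-𝔑-zero m = coeff-∑<-zero (suc m) (λ j → const (a j) * q ^ suc j) λ j → coeff-monomial-zero (a j) j
  where
  a : ℕ → ℚ
  a j = (+ 1 ℚ./ suc m) ℚ.* binom (suc m) j ℚ.* binom (suc m) (suc j)

coeff-𝔑-suc : ∀ m i → coeff (𝔑 (suc m)) (suc i)
  ≡ binom m i ℚ.* binom (suc m) (suc i) ℚ.- binom m (suc i) ℚ.* binom (suc m) i
coeff-𝔑-suc m i = begin
  coeff (𝔑 (suc m)) (suc i)
    ≡⟨ coeff-∑<-cong (suc m) (λ j → const (a j) * q ^ suc j) (λ j → const (a j) * q ^ j)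
      (λ j → coeff-monomial-suc (a j) j i) ⟩
  coeff (∑< (suc m) (λ j → const (a j) * q ^ j)) i  ≡⟨ coeff-∑<-monomials (suc m) a i vanish ⟩
  a i                                               ≡⟨ narayana-difference m i ⟩
  binom m i ℚ.* binom (suc m) (suc i) ℚ.- binom m (suc i) ℚ.* binom (suc m) i ∎
  where
  open ≡.≡-Reasoning
  a : ℕ → ℚ
  a j = (+ 1 ℚ./ suc m) ℚ.* binom (suc m) j ℚ.* binom (suc m) (suc j)

  vanish : ∀ k → suc m ℕ.≤ k → a k ≡ 0ℚ
  vanish k m<k = trans (cong (λ c → (+ 1 ℚ./ suc m) ℚ.* binom (suc m) k ℚ.* fromℕ c)
      (k>n⇒nCk≡0 {suc m} {suc k} (s≤s m<k)))
    (ℚ.*-zeroʳ ((+ 1 ℚ./ suc m) ℚ.* binom (suc m) k))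

-- Coefficients of the powers of the Narayana series.

-- The coefficient of q^(s + 1) in power (1 - q) (m + 1) (n - m).
powerCoeff : ℕ → ℕ → ℕ → ℚ
powerCoeff m n s = binom m s ℚ.* binom n (suc s) ℚ.- binom m (suc s) ℚ.* binom n s

-- Bilinearity of the determinant: with a = (x₀, x₁), b = (x₁, x₂), c = (y₀, y₁), d = (y₁, y₂),
-- Pascal's rule makes the new rows a + b and c + d, and det(a + b, c + d) = det(a + b, d) + det(b,
-- c + d) - det(b, d) + det(a, c).
powerCoeff-identity : ∀ x₀ x₁ x₂ y₀ y₁ y₂ {X₁ X₂ Y₁ Y₂} →
  X₁ ≡ x₀ ℚ.+ x₁ → X₂ ≡ x₁ ℚ.+ x₂ → Y₁ ≡ y₀ ℚ.+ y₁ → Y₂ ≡ y₁ ℚ.+ y₂ →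
  X₁ ℚ.* Y₂ ℚ.- X₂ ℚ.* Y₁ ≡ (X₁ ℚ.* y₂ ℚ.- X₂ ℚ.* y₁)
    ℚ.+ ((x₁ ℚ.* Y₂ ℚ.- x₂ ℚ.* Y₁) ℚ.- ((x₁ ℚ.* y₂ ℚ.- x₂ ℚ.* y₁) ℚ.- (x₀ ℚ.* y₁ ℚ.- x₁ ℚ.* y₀)))
powerCoeff-identity x₀ x₁ x₂ y₀ y₁ y₂ refl refl refl refl =
  solve 6 (λ x₀ x₁ x₂ y₀ y₁ y₂ → (x₀ :+ x₁) :* (y₁ :+ y₂) :- (x₁ :+ x₂) :* (y₀ :+ y₁)
    := ((x₀ :+ x₁) :* y₂ :- (x₁ :+ x₂) :* y₁) :+ ((x₁ :* (y₁ :+ y₂) :- x₂ :* (y₀ :+ y₁))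
         :- ((x₁ :* y₂ :- x₂ :* y₁) :- (x₀ :* y₁ :- x₁ :* y₀)))) refl x₀ x₁ x₂ y₀ y₁ y₂
  where open ℚ-Solver

-- The left edge of Pascal's triangle, with 0 as the entry in column -1. The determinant using that
-- column is 0, in agreement with the vanishing constant coefficient.
powerCoeff-zero : ∀ m n → powerCoeff (suc m) (suc n) 0
  ≡ powerCoeff (suc m) n 0 ℚ.+ (powerCoeff m (suc n) 0 ℚ.- (powerCoeff m n 0 ℚ.- 0ℚ))
powerCoeff-zero m n = powerCoeff-identity 0ℚ 1ℚ (binom m 1) 0ℚ 1ℚ (binom n 1)
  refl (binom-pascal m 0) refl (binom-pascal n 0)

powerCoeff-suc : ∀ m n s → powerCoeff (suc m) (suc n) (suc s)
  ≡ powerCoeff (suc m) n (suc s) ℚ.+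
      (powerCoeff m (suc n) (suc s) ℚ.- (powerCoeff m n (suc s) ℚ.- powerCoeff m n s))
powerCoeff-suc m n s = powerCoeff-identity
  (binom m s) (binom m (suc s)) (binom m (suc (suc s))) (binom n s) (binom n (suc s))
      (binom n (suc (suc s)))
  (binom-pascal m s) (binom-pascal m (suc s)) (binom-pascal n s) (binom-pascal n (suc s))

coeff-power-step : ∀ m j i → coeff (power (1# - q) (suc m) (suc j)) i
  ≡ coeff (power (1# - q) (suc m) j) i
    ℚ.+ (coeff (power (1# - q) m (suc (suc j))) i ℚ.- coeff ((1# - q) * power (1# - q) m (suc j)) i)
coeff-power-step m j i = trans (coeff-+ (P (suc m) j) (P m (suc (suc j)) - (1# - q) * P m (suc j)) i)
  (cong (coeff (P (suc m) j) i ℚ.+_) (trans (coeff-+ (P m (suc (suc j))) (- ((1# - q) * P m (suc j))) i)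
    (cong (coeff (P m (suc (suc j))) i ℚ.+_) (coeff-neg ((1# - q) * P m (suc j)) i))))
  where
  P : ℕ → ℕ → Poly
  P = power (1# - q)

-- At q = 0 one has c = 1, and N = 1 solves N = 1 + z N (N - 1); no positive power of z survives.
coeff-power-zero : ∀ m j → coeff (power (1# - q) (suc m) j) 0 ≡ 0ℚ
coeff-power-zero m zero    = refl
coeff-power-zero m (suc j) = begin
  coeff (P (suc m) (suc j)) 0
    ≡⟨ coeff-power-step m j 0 ⟩
  coeff (P (suc m) j) 0 ℚ.+ (coeff (P m (suc (suc j))) 0 ℚ.- coeff ((1# - q) * P m (suc j)) 0)
    ≡⟨ cong₂ (λ x y → x ℚ.+ (coeff (P m (suc (suc j))) 0 ℚ.- y)) (coeff-power-zero m j)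
         (coeff-[1-q]*-zero (P m (suc j))) ⟩
  0ℚ ℚ.+ (coeff (P m (suc (suc j))) 0 ℚ.- coeff (P m (suc j)) 0)
    ≡⟨ cong (0ℚ ℚ.+_) (difference m) ⟩
  0ℚ ∎
  where
  open ≡.≡-Reasoning
  P : ℕ → ℕ → Poly
  P = power (1# - q)

  difference : ∀ m → coeff (P m (suc (suc j))) 0 ℚ.- coeff (P m (suc j)) 0 ≡ 0ℚ
  difference zero    = refl
  difference (suc m) = cong₂ ℚ._-_ (coeff-power-zero m (suc (suc j))) (coeff-power-zero m (suc j))

-- At `j = 0` the two rows of the determinant agree, so it vanishes like the corresponding
-- coefficient of N^0. Each increase of `j` moves the second row down by one.
coeff-power-suc : ∀ m j s → coeff (power (1# - q) (suc m) j) (suc s) ≡ powerCoeff m (j ℕ.+ m) s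
coeff-power-suc m zero s =
  sym (trans (cong (ℚ._- binom m (suc s) ℚ.* binom m s) (ℚ.*-comm (binom m s) (binom m (suc s))))
  (ℚ.+-inverseʳ (binom m (suc s) ℚ.* binom m s)))
coeff-power-suc m (suc j) s = begin
  coeff (P (suc m) (suc j)) (suc s)
    ≡⟨ coeff-power-step m j (suc s) ⟩
  coeff (P (suc m) j) (suc s) ℚ.+
      (coeff (P m (suc (suc j))) (suc s) ℚ.- coeff ((1# - q) * P m (suc j)) (suc s))
    ≡⟨ cong₂ (λ x y → x ℚ.+ (coeff (P m (suc (suc j))) (suc s) ℚ.- y)) (coeff-power-suc m j s)
         (coeff-[1-q]*-suc (P m (suc j)) s) ⟩
  powerCoeff m (j ℕ.+ m) s ℚ.+
      (coeff (P m (suc (suc j))) (suc s) ℚ.- (coeff (P m (suc j)) (suc s) ℚ.- coeff (P m (suc j)) s))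
    ≡⟨ step m s ⟩
  powerCoeff m (suc j ℕ.+ m) s ∎
  where
  open ≡.≡-Reasoning
  P : ℕ → ℕ → Poly
  P = power (1# - q)

  step : ∀ m s → powerCoeff m (j ℕ.+ m) s ℚ.+
      (coeff (P m (suc (suc j))) (suc s) ℚ.- (coeff (P m (suc j)) (suc s) ℚ.- coeff (P m (suc j)) s))
    ≡ powerCoeff m (suc j ℕ.+ m) s
  -- For `m = 0` the recursion refers to the constant terms 1 of the powers of N, which are not of
  -- determinant form, so this case is computed directly: the coefficient of z in N^j is j q.
  step zero    zero    = begin
    (1ℚ ℚ.* b ℚ.- 0ℚ) ℚ.+ 1ℚ               ≡⟨ cong (λ x → x ℚ.- 0ℚ ℚ.+ 1ℚ) (ℚ.*-identityˡ b) ⟩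
    b ℚ.- 0ℚ ℚ.+ 1ℚ
      ≡⟨ solve 1 (λ b → b :- con 0ℚ :+ con 1ℚ := con 1ℚ :* (con 1ℚ :+ b) :- con 0ℚ) refl b ⟩
    1ℚ ℚ.* (1ℚ ℚ.+ b) ℚ.- 0ℚ               ≡⟨ cong (λ x → 1ℚ ℚ.* x ℚ.- 0ℚ) (binom-pascal (j ℕ.+ 0) 0) ⟨
    powerCoeff 0 (suc j ℕ.+ 0) 0           ∎
    where
    open ℚ-Solver
    b : ℚ
    b = binom (j ℕ.+ 0) 1
  step zero    (suc s) = begin
    (0ℚ ℚ.* binom N (suc (suc s)) ℚ.- 0ℚ ℚ.* binom N (suc s)) ℚ.+ 0ℚ
      ≡⟨ cong (ℚ._+ 0ℚ) (cong₂ ℚ._-_ (ℚ.*-zeroˡ (binom N (suc (suc s)))) (ℚ.*-zeroˡ (binom N (suc s)))) ⟩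
    0ℚ  ≡⟨ cong₂ ℚ._-_ (ℚ.*-zeroˡ (binom (suc N) (suc (suc s)))) (ℚ.*-zeroˡ (binom (suc N) (suc s))) ⟨
    0ℚ ℚ.* binom (suc N) (suc (suc s)) ℚ.- 0ℚ ℚ.* binom (suc N) (suc s) ∎
    where
    N : ℕ
    N = j ℕ.+ 0
  step (suc m) zero    = begin
    powerCoeff (suc m) (j ℕ.+ suc m) 0 ℚ.+
        (coeff (P (suc m) (suc (suc j))) 1 ℚ.-
        (coeff (P (suc m) (suc j)) 1 ℚ.- coeff (P (suc m) (suc j)) 0))
      ≡⟨ cong₂ ℚ._+_ (cong (λ n → powerCoeff (suc m) n 0) (ℕ.+-suc j m))
           (cong₂ ℚ._-_ (coeff-power-suc m (suc (suc j)) 0)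
               (cong₂ ℚ._-_ (coeff-power-suc m (suc j) 0) (coeff-power-zero m (suc j)))) ⟩
    powerCoeff (suc m) (suc j ℕ.+ m) 0 ℚ.+
        (powerCoeff m (suc (suc j) ℕ.+ m) 0 ℚ.- (powerCoeff m (suc j ℕ.+ m) 0 ℚ.- 0ℚ))
      ≡⟨ powerCoeff-zero m (suc j ℕ.+ m) ⟨
    powerCoeff (suc m) (suc (suc j ℕ.+ m)) 0
      ≡⟨ cong (λ n → powerCoeff (suc m) (suc n) 0) (ℕ.+-suc j m) ⟨
    powerCoeff (suc m) (suc j ℕ.+ suc m) 0 ∎
  step (suc m) (suc s) = begin
    powerCoeff (suc m) (j ℕ.+ suc m) (suc s) ℚ.+
        (coeff (P (suc m) (suc (suc j))) (suc (suc s)) ℚ.-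
        (coeff (P (suc m) (suc j)) (suc (suc s)) ℚ.- coeff (P (suc m) (suc j)) (suc s)))
      ≡⟨ cong₂ ℚ._+_ (cong (λ n → powerCoeff (suc m) n (suc s)) (ℕ.+-suc j m))
           (cong₂ ℚ._-_ (coeff-power-suc m (suc (suc j)) (suc s))
               (cong₂ ℚ._-_ (coeff-power-suc m (suc j) (suc s)) (coeff-power-suc m (suc j) s))) ⟩
    powerCoeff (suc m) (suc j ℕ.+ m) (suc s) ℚ.+
        (powerCoeff m (suc (suc j) ℕ.+ m) (suc s) ℚ.-
        (powerCoeff m (suc j ℕ.+ m) (suc s) ℚ.- powerCoeff m (suc j ℕ.+ m) s))
      ≡⟨ powerCoeff-suc m (suc j ℕ.+ m) s ⟨
    powerCoeff (suc m) (suc (suc j ℕ.+ m)) (suc s)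
      ≡⟨ cong (λ n → powerCoeff (suc m) (suc n) (suc s)) (ℕ.+-suc j m) ⟨
    powerCoeff (suc m) (suc j ℕ.+ suc m) (suc s) ∎

-- At `j = 1` the second row is m + 1, and the determinant is the one found for the Narayana
-- numbers.
𝔑≈power : ∀ k → 𝔑 k ≈ power (1# - q) k 1
𝔑≈power zero    i       = refl
𝔑≈power (suc m) zero    = trans (coeff-𝔑-zero m) (sym (coeff-power-zero m 1))
𝔑≈power (suc m) (suc s) = trans (coeff-𝔑-suc m s) (sym (coeff-power-suc m 1 s))

-- Coefficients of the Motzkin polynomials.

-- The coefficient of q^(s + 1) in motzkin (1 + q) q n i is motzkinCoeff n s (s + i + 1).
motzkinCoeff : ℕ → ℕ → ℕ → ℚ
motzkinCoeff n s t = binom n (suc s) ℚ.* binom n t ℚ.- binom n s ℚ.* binom n (suc t)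

-- The full bilinear expansion of a determinant whose two rows are sums by Pascal's rule. In order,
-- the four terms belong to the up step, the level steps of weight 1 and q, and the down step, that
-- is, to the expansion of (1 + t)(1 + q/t).
motzkinCoeff-identity : ∀ x₀ x₁ x₂ y₀ y₁ y₂ {X₁ X₂ Y₁ Y₂} →
  X₁ ≡ x₀ ℚ.+ x₁ → X₂ ≡ x₁ ℚ.+ x₂ → Y₁ ≡ y₀ ℚ.+ y₁ → Y₂ ≡ y₁ ℚ.+ y₂ →
  (x₂ ℚ.* y₀ ℚ.- x₁ ℚ.* y₁) ℚ.+
      (((x₂ ℚ.* y₁ ℚ.- x₁ ℚ.* y₂) ℚ.+ (x₁ ℚ.* y₀ ℚ.- x₀ ℚ.* y₁)) ℚ.+ (x₁ ℚ.* y₁ ℚ.- x₀ ℚ.* y₂))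
    ≡ X₂ ℚ.* Y₁ ℚ.- X₁ ℚ.* Y₂
motzkinCoeff-identity x₀ x₁ x₂ y₀ y₁ y₂ refl refl refl refl =
  solve 6 (λ x₀ x₁ x₂ y₀ y₁ y₂ →
    (x₂ :* y₀ :- x₁ :* y₁) :+ (((x₂ :* y₁ :- x₁ :* y₂) :+ (x₁ :* y₀ :- x₀ :* y₁)) :+ (x₁ :* y₁ :- x₀ :* y₂))
      := (x₁ :+ x₂) :* (y₀ :+ y₁) :- (x₀ :+ x₁) :* (y₁ :+ y₂)) refl x₀ x₁ x₂ y₀ y₁ y₂
  where open ℚ-Solver

-- The plain binomials are the determinants at column -1, where the entries are 0 and 1; `unit`
-- restores this form.
motzkinCoeff-zero : ∀ n t →
  motzkinCoeff n 0 t ℚ.+ ((motzkinCoeff n 0 (suc t) ℚ.+ binom n t) ℚ.+ binom n (suc t))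
      ≡ motzkinCoeff (suc n) 0 (suc t)
motzkinCoeff-zero n t = begin
  motzkinCoeff n 0 t ℚ.+ ((motzkinCoeff n 0 (suc t) ℚ.+ binom n t) ℚ.+ binom n (suc t))
    ≡⟨ cong₂ (λ x y → motzkinCoeff n 0 t ℚ.+ ((motzkinCoeff n 0 (suc t) ℚ.+ x) ℚ.+ y))
         (unit (binom n t) (binom n (suc t))) (unit (binom n (suc t)) (binom n (suc (suc t)))) ⟩
  motzkinCoeff n 0 t ℚ.+ ((motzkinCoeff n 0 (suc t) ℚ.+ (1ℚ ℚ.* binom n t ℚ.- 0ℚ ℚ.* binom n (suc t)))
    ℚ.+ (1ℚ ℚ.* binom n (suc t) ℚ.- 0ℚ ℚ.* binom n (suc (suc t))))
    ≡⟨ motzkinCoeff-identity 0ℚ 1ℚ (binom n 1) (binom n t) (binom n (suc t)) (binom n (suc (suc t)))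
         refl (binom-pascal n 0) (binom-pascal n t) (binom-pascal n (suc t)) ⟩
  motzkinCoeff (suc n) 0 (suc t) ∎
  where
  open ≡.≡-Reasoning
  open ℚ-Solver
  unit : ∀ x y → x ≡ 1ℚ ℚ.* x ℚ.- 0ℚ ℚ.* y
  unit = solve 2 (λ x y → x := con 1ℚ :* x :- con 0ℚ :* y) refl

motzkinCoeff-suc : ∀ n s t →
  motzkinCoeff n (suc s) t ℚ.+
      ((motzkinCoeff n (suc s) (suc t) ℚ.+ motzkinCoeff n s t) ℚ.+ motzkinCoeff n s (suc t))
    ≡ motzkinCoeff (suc n) (suc s) (suc t)
motzkinCoeff-suc n s t = motzkinCoeff-identity
  (binom n s) (binom n (suc s)) (binom n (suc (suc s))) (binom n t) (binom n (suc t))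
      (binom n (suc (suc t)))
  (binom-pascal n s) (binom-pascal n (suc s)) (binom-pascal n t) (binom-pascal n (suc t))

-- This is the value at height -1. It supplies the up-step term that the Motzkin recursion lacks at
-- height 0.
motzkinCoeff-diagonal : ∀ n s → motzkinCoeff n s s ≡ 0ℚ
motzkinCoeff-diagonal n s =
  trans (cong (ℚ._- binom n s ℚ.* binom n (suc s)) (ℚ.*-comm (binom n (suc s)) (binom n s)))
  (ℚ.+-inverseʳ (binom n s ℚ.* binom n (suc s)))

private
  M : ℕ → ℕ → Poly
  M = motzkin (1# + q) q

-- At q = 0 down steps are excluded and level steps have weight 1, so a path is a choice of its i up
-- steps.
coeff-motzkin-zero : ∀ n i → coeff (M n i) 0 ≡ binom n i
coeff-motzkin-zero zero    zero    = refl
coeff-motzkin-zero zero    (suc i) = refl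
coeff-motzkin-zero (suc n) zero    = begin
  coeff ((1# + q) * M n 0 + q * M n 1) 0                 ≡⟨ coeff-+ ((1# + q) * M n 0) (q * M n 1) 0 ⟩
  coeff ((1# + q) * M n 0) 0 ℚ.+ coeff (q * M n 1) 0
    ≡⟨ cong₂ ℚ._+_ (trans (coeff-[1+q]*-zero (M n 0)) (coeff-motzkin-zero n 0)) (coeff-q*-zero (M n 1)) ⟩
  binom (suc n) 0                                        ∎
  where open ≡.≡-Reasoning
coeff-motzkin-zero (suc n) (suc i) = begin
  coeff (M n i + ((1# + q) * M n (suc i) + q * M n (suc (suc i)))) 0
    ≡⟨ coeff-+ (M n i) ((1# + q) * M n (suc i) + q * M n (suc (suc i))) 0 ⟩
  coeff (M n i) 0 ℚ.+ coeff ((1# + q) * M n (suc i) + q * M n (suc (suc i))) 0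
    ≡⟨ cong₂ ℚ._+_ (coeff-motzkin-zero n i)
         (trans (coeff-+ ((1# + q) * M n (suc i)) (q * M n (suc (suc i))) 0)
         (trans (cong₂ ℚ._+_ (trans (coeff-[1+q]*-zero (M n (suc i))) (coeff-motzkin-zero n (suc i)))
             (coeff-q*-zero (M n (suc (suc i))))) (ℚ.+-identityʳ _))) ⟩
  binom n i ℚ.+ binom n (suc i)
    ≡⟨ binom-pascal n i ⟨
  binom (suc n) (suc i) ∎
  where open ≡.≡-Reasoning

coeff-level-down : ∀ p r s → coeff ((1# + q) * p + q * r) (suc s)
  ≡ (coeff p (suc s) ℚ.+ coeff p s) ℚ.+ coeff r s
coeff-level-down p r s = trans (coeff-+ ((1# + q) * p) (q * r) (suc s))
  (cong₂ ℚ._+_ (coeff-[1+q]*-suc p s) (coeff-q*-suc r s))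

coeff-motzkin-suc : ∀ n i s → coeff (M n i) (suc s) ≡ motzkinCoeff n s (suc (s ℕ.+ i))
coeff-motzkin-suc zero i s = trans (vanish i) (sym (trans
  (cong₂ ℚ._-_ (ℚ.*-zeroˡ 0ℚ) (ℚ.*-zeroʳ (binom 0 s))) refl))
  where
  vanish : ∀ i → coeff (M 0 i) (suc s) ≡ 0ℚ
  vanish zero    = refl
  vanish (suc i) = refl
coeff-motzkin-suc (suc n) zero zero = begin
  coeff ((1# + q) * M n 0 + q * M n 1) 1
    ≡⟨ coeff-level-down (M n 0) (M n 1) 0 ⟩
  (coeff (M n 0) 1 ℚ.+ coeff (M n 0) 0) ℚ.+ coeff (M n 1) 0
    ≡⟨ cong₂ ℚ._+_ (cong₂ ℚ._+_ (coeff-motzkin-suc n 0 0) (coeff-motzkin-zero n 0))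
         (coeff-motzkin-zero n 1) ⟩
  (motzkinCoeff n 0 1 ℚ.+ binom n 0) ℚ.+ binom n 1
    ≡⟨ trans (cong (ℚ._+ ((motzkinCoeff n 0 1 ℚ.+ binom n 0) ℚ.+ binom n 1))
         (motzkinCoeff-diagonal n 0)) (ℚ.+-identityˡ _) ⟨
  motzkinCoeff n 0 0 ℚ.+ ((motzkinCoeff n 0 1 ℚ.+ binom n 0) ℚ.+ binom n 1)
    ≡⟨ motzkinCoeff-zero n 0 ⟩
  motzkinCoeff (suc n) 0 1 ∎
  where open ≡.≡-Reasoning
coeff-motzkin-suc (suc n) zero (suc s) = begin
  coeff ((1# + q) * M n 0 + q * M n 1) (suc (suc s))
    ≡⟨ coeff-level-down (M n 0) (M n 1) (suc s) ⟩
  (coeff (M n 0) (suc (suc s)) ℚ.+ coeff (M n 0) (suc s)) ℚ.+ coeff (M n 1) (suc s)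
    ≡⟨ cong₂ ℚ._+_ (cong₂ ℚ._+_ (coeff-motzkin-suc n 0 (suc s)) (coeff-motzkin-suc n 0 s))
         (trans (coeff-motzkin-suc n 1 s) (cong (motzkinCoeff n s ∘ suc) (ℕ.+-suc s 0))) ⟩
  (motzkinCoeff n (suc s) (suc t) ℚ.+ motzkinCoeff n s t) ℚ.+ motzkinCoeff n s (suc t)
    ≡⟨ trans (cong (ℚ._+ ((motzkinCoeff n (suc s) (suc t) ℚ.+ motzkinCoeff n s t) ℚ.+ motzkinCoeff n s
         (suc t)))
         (trans (cong (motzkinCoeff n (suc s) ∘ suc) (ℕ.+-identityʳ s))
             (motzkinCoeff-diagonal n (suc s)))) (ℚ.+-identityˡ _) ⟨
  motzkinCoeff n (suc s) t ℚ.+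
      ((motzkinCoeff n (suc s) (suc t) ℚ.+ motzkinCoeff n s t) ℚ.+ motzkinCoeff n s (suc t))
    ≡⟨ motzkinCoeff-suc n s t ⟩
  motzkinCoeff (suc n) (suc s) (suc t) ∎
  where
  open ≡.≡-Reasoning
  t : ℕ
  t = suc (s ℕ.+ 0)
coeff-motzkin-suc (suc n) (suc i) zero = begin
  coeff (M n i + ((1# + q) * M n (suc i) + q * M n (suc (suc i)))) 1
    ≡⟨ trans (coeff-+ (M n i) ((1# + q) * M n (suc i) + q * M n (suc (suc i))) 1)
         (cong (coeff (M n i) 1 ℚ.+_) (coeff-level-down (M n (suc i)) (M n (suc (suc i))) 0)) ⟩
  coeff (M n i) 1 ℚ.+ ((coeff (M n (suc i)) 1 ℚ.+ coeff (M n (suc i)) 0) ℚ.+ coeff (M n (suc (suc i))) 0)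
    ≡⟨ cong₂ ℚ._+_ (coeff-motzkin-suc n i 0)
         (cong₂ ℚ._+_ (cong₂ ℚ._+_ (coeff-motzkin-suc n (suc i) 0) (coeff-motzkin-zero n (suc i)))
         (coeff-motzkin-zero n (suc (suc i)))) ⟩
  motzkinCoeff n 0 (suc i) ℚ.+
      ((motzkinCoeff n 0 (suc (suc i)) ℚ.+ binom n (suc i)) ℚ.+ binom n (suc (suc i)))
    ≡⟨ motzkinCoeff-zero n (suc i) ⟩
  motzkinCoeff (suc n) 0 (suc (suc i)) ∎
  where open ≡.≡-Reasoning
coeff-motzkin-suc (suc n) (suc i) (suc s) = begin
  coeff (M n i + ((1# + q) * M n (suc i) + q * M n (suc (suc i)))) (suc (suc s))
    ≡⟨ trans (coeff-+ (M n i) ((1# + q) * M n (suc i) + q * M n (suc (suc i))) (suc (suc s)))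
         (cong (coeff (M n i) (suc (suc s)) ℚ.+_)
         (coeff-level-down (M n (suc i)) (M n (suc (suc i))) (suc s))) ⟩
  coeff (M n i) (suc (suc s)) ℚ.+
      ((coeff (M n (suc i)) (suc (suc s)) ℚ.+ coeff (M n (suc i)) (suc s)) ℚ.+ coeff (M n (suc (suc i)))
      (suc s))
    ≡⟨ cong₂ ℚ._+_ (coeff-motzkin-suc n i (suc s)) (cong₂ ℚ._+_
         (cong₂ ℚ._+_ (trans (coeff-motzkin-suc n (suc i) (suc s))
             (cong (motzkinCoeff n (suc s) ∘ suc ∘ suc) (ℕ.+-suc s i)))
                      (trans (coeff-motzkin-suc n (suc i) s) (cong (motzkinCoeff n s ∘ suc) (ℕ.+-suc s i))))
         (trans (coeff-motzkin-suc n (suc (suc i)) s)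
             (cong (motzkinCoeff n s ∘ suc) (trans (ℕ.+-suc s (suc i)) (cong suc (ℕ.+-suc s i)))))) ⟩
  motzkinCoeff n (suc s) t ℚ.+
      ((motzkinCoeff n (suc s) (suc t) ℚ.+ motzkinCoeff n s t) ℚ.+ motzkinCoeff n s (suc t))
    ≡⟨ motzkinCoeff-suc n s t ⟩
  motzkinCoeff (suc n) (suc s) (suc t)
    ≡⟨ cong (motzkinCoeff (suc n) (suc s) ∘ suc ∘ suc) (ℕ.+-suc s i) ⟨
  motzkinCoeff (suc n) (suc s) (suc (suc s ℕ.+ suc i)) ∎
  where
  open ≡.≡-Reasoning
  t : ℕ
  t = suc (suc (s ℕ.+ i))

const-fromℕ≈ι : ∀ n → const (fromℕ n) ≈ ι n
const-fromℕ≈ι zero    zero    = refl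
const-fromℕ≈ι zero    (suc i) = refl
const-fromℕ≈ι (suc n) i       = begin
  coeff (const (fromℕ (suc n))) i         ≡⟨ cong (λ a → coeff (const a) i) (fromℕ-+ 1 n) ⟩
  coeff (1# + const (fromℕ n)) i          ≡⟨ coeff-+ 1# (const (fromℕ n)) i ⟩
  coeff 1# i ℚ.+ coeff (const (fromℕ n)) i ≡⟨ cong (coeff 1# i ℚ.+_) (const-fromℕ≈ι n i) ⟩
  coeff 1# i ℚ.+ coeff (ι n) i            ≡⟨ coeff-+ 1# (ι n) i ⟨
  coeff (ι (suc n)) i                     ∎
  where open ≡.≡-Reasoning

-- The Narayana determinant has rows n and n + 1, the Motzkin one only row n. Expanding row n + 1 by
-- Pascal's rule, the product `x₁ * x₂` cancels and x₁² - x₀ x₂ remains.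
𝔑≈q*motzkin : ∀ n → 𝔑 (n ℕ.+ 1) ≈ q * M n 0
𝔑≈q*motzkin n i = trans (cong (λ k → coeff (𝔑 k) i) (ℕ.+-comm n 1)) (shifted i)
  where
  open ≡.≡-Reasoning

  difference : ∀ s → binom n s ℚ.* binom (suc n) (suc s) ℚ.- binom n (suc s) ℚ.* binom (suc n) s
      ≡ coeff (M n 0) s
  difference zero    = begin
    1ℚ ℚ.* binom (suc n) 1 ℚ.- binom n 1 ℚ.* 1ℚ
      ≡⟨ cong (λ x → 1ℚ ℚ.* x ℚ.- binom n 1 ℚ.* 1ℚ) (binom-pascal n 0) ⟩
    1ℚ ℚ.* (1ℚ ℚ.+ binom n 1) ℚ.- binom n 1 ℚ.* 1ℚ  ≡⟨ unit (binom n 1) ⟩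
    1ℚ                                           ≡⟨ coeff-motzkin-zero n 0 ⟨
    coeff (M n 0) 0                              ∎
    where
    open ℚ-Solver
    unit : ∀ x → 1ℚ ℚ.* (1ℚ ℚ.+ x) ℚ.- x ℚ.* 1ℚ ≡ 1ℚ
    unit = solve 1 (λ x → con 1ℚ :* (con 1ℚ :+ x) :- x :* con 1ℚ := con 1ℚ) refl
  difference (suc s) = begin
    x₁ ℚ.* binom (suc n) (suc (suc s)) ℚ.- x₂ ℚ.* binom (suc n) (suc s)
      ≡⟨ cong₂ (λ y z → x₁ ℚ.* y ℚ.- x₂ ℚ.* z) (binom-pascal n (suc s)) (binom-pascal n s) ⟩
    x₁ ℚ.* (x₁ ℚ.+ x₂) ℚ.- x₂ ℚ.* (x₀ ℚ.+ x₁)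
      ≡⟨ expand x₀ x₁ x₂ ⟩
    motzkinCoeff n s (suc s)
      ≡⟨ cong (motzkinCoeff n s ∘ suc) (ℕ.+-identityʳ s) ⟨
    motzkinCoeff n s (suc (s ℕ.+ 0))
      ≡⟨ coeff-motzkin-suc n 0 s ⟨
    coeff (M n 0) (suc s) ∎
    where
    x₀ x₁ x₂ : ℚ
    x₀ = binom n s
    x₁ = binom n (suc s)
    x₂ = binom n (suc (suc s))

    open ℚ-Solver
    expand : ∀ x₀ x₁ x₂ → x₁ ℚ.* (x₁ ℚ.+ x₂) ℚ.- x₂ ℚ.* (x₀ ℚ.+ x₁) ≡ x₁ ℚ.* x₁ ℚ.- x₀ ℚ.* x₂
    expand = solve 3 (λ x₀ x₁ x₂ → x₁ :* (x₁ :+ x₂) :- x₂ :* (x₀ :+ x₁) := x₁ :* x₁ :- x₀ :* x₂) refl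

  shifted : ∀ i → coeff (𝔑 (suc n)) i ≡ coeff (q * M n 0) i
  shifted zero    = trans (coeff-𝔑-zero n) (sym (coeff-q*-zero (M n 0)))
  shifted (suc s) = trans (coeff-𝔑-suc n s) (trans (difference s) (sym (coeff-q*-suc (M n 0) s)))

-- Substitution for the indeterminate.

module Substitution (r : Poly) where

  ⟦⟧-+ : ∀ p s → (p + s) ⟦ r ⟧ ≈ p ⟦ r ⟧ + s ⟦ r ⟧
  ⟦⟧-+ []      s       i = refl
  ⟦⟧-+ (a ∷ p) []      i = sym (Poly.+-identityʳ ((a ∷ p) ⟦ r ⟧) i)
  ⟦⟧-+ (a ∷ p) (b ∷ s) i = horner-+ r (const a) (const b) (p ⟦ r ⟧) (s ⟦ r ⟧) {(p + s) ⟦ r ⟧} (⟦⟧-+ p s) i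

  const-0≈0 : ∀ {a} → a ≡ 0ℚ → const a ≈ 0#
  const-0≈0 refl zero    = refl
  const-0≈0 refl (suc i) = refl

  -- Equal polynomials may be lists of different lengths; this disposes of the surplus tail of zeros
  -- in `⟦⟧-cong`.
  ⟦⟧-zero : ∀ p → p ≈ 0# → p ⟦ r ⟧ ≈ 0#
  ⟦⟧-zero []      p≈0 i = refl
  ⟦⟧-zero (a ∷ p) p≈0 i = trans
    (horner-cong r {const a} {0#} {p ⟦ r ⟧} {0#} (const-0≈0 (p≈0 0)) (⟦⟧-zero p (p≈0 ∘ suc)) i)
    (0+r*0≈0 r i)

  ⟦⟧-cong : ∀ p s → p ≈ s → p ⟦ r ⟧ ≈ s ⟦ r ⟧
  ⟦⟧-cong []      s       p≈s i = sym (⟦⟧-zero s (sym ∘ p≈s) i)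
  ⟦⟧-cong (a ∷ p) []      p≈s i = ⟦⟧-zero (a ∷ p) p≈s i
  ⟦⟧-cong (a ∷ p) (b ∷ s) p≈s i = horner-cong r {const a} {const b} {p ⟦ r ⟧} {s ⟦ r ⟧}
    (λ j → cong (λ c → coeff (const c) j) (p≈s 0)) (⟦⟧-cong p s (p≈s ∘ suc)) i

  -- The Motzkin recursion multiplies only by `q` and `1# + q`; these two cases of multiplicativity
  -- carry substitution through it.
  ⟦⟧-q* : ∀ p → (q * p) ⟦ r ⟧ ≈ r * p ⟦ r ⟧
  ⟦⟧-q* p i = trans (⟦⟧-cong (q * p) (0ℚ ∷ p) (q*p≈0∷p p) i)
    (trans (coeff-+ (const 0ℚ) (r * p ⟦ r ⟧) i)
      (trans (cong (ℚ._+ coeff (r * p ⟦ r ⟧) i) (const-0≈0 refl i)) (ℚ.+-identityˡ _)))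

  ⟦⟧-[1+q]* : ∀ p → ((1# + q) * p) ⟦ r ⟧ ≈ (1# + r) * p ⟦ r ⟧
  ⟦⟧-[1+q]* p i = begin
    coeff (((1# + q) * p) ⟦ r ⟧) i        ≡⟨ ⟦⟧-cong ((1# + q) * p) (p + q * p) ([1+q]*p≈p+q*p p) i ⟩
    coeff ((p + q * p) ⟦ r ⟧) i           ≡⟨ ⟦⟧-+ p (q * p) i ⟩
    coeff (p ⟦ r ⟧ + (q * p) ⟦ r ⟧) i     ≡⟨ Poly.+-cong {p ⟦ r ⟧} {p ⟦ r ⟧} (λ _ → refl) (⟦⟧-q* p) i ⟩
    coeff (p ⟦ r ⟧ + r * p ⟦ r ⟧) i       ≡⟨ x+r*x≈[1+r]*x r (p ⟦ r ⟧) i ⟩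
    coeff ((1# + r) * p ⟦ r ⟧) i          ∎
    where open ≡.≡-Reasoning

  ⟦⟧-level-down : ∀ p s {p′ s′} → p ⟦ r ⟧ ≈ p′ → s ⟦ r ⟧ ≈ s′ →
    ((1# + q) * p + q * s) ⟦ r ⟧ ≈ (1# + r) * p′ + r * s′
  ⟦⟧-level-down p s {p′} {s′} p≈p′ s≈s′ i = trans (⟦⟧-+ ((1# + q) * p) (q * s) i)
    (Poly.+-cong {((1# + q) * p) ⟦ r ⟧} {(1# + r) * p′} {(q * s) ⟦ r ⟧} {r * s′}
      (λ j → trans (⟦⟧-[1+q]* p j) (Poly.*-cong {1# + r} {1# + r} {p ⟦ r ⟧} {p′} (λ _ → refl) p≈p′ j))
      (λ j → trans (⟦⟧-q* s j) (Poly.*-cong {r} {r} {s ⟦ r ⟧} {s′} (λ _ → refl) s≈s′ j)) i)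

  ⟦⟧-motzkin : ∀ n i → M n i ⟦ r ⟧ ≈ motzkin (1# + r) r n i
  ⟦⟧-motzkin zero    zero    j =
      trans (Poly.+-cong {1#} {1#} {r * 0#} {0#} (λ _ → refl) (Poly.zeroʳ r) j) (Poly.+-identityʳ 1# j)
  ⟦⟧-motzkin zero    (suc i) j = refl
  ⟦⟧-motzkin (suc n) zero    j = ⟦⟧-level-down (M n 0) (M n 1) (⟦⟧-motzkin n 0) (⟦⟧-motzkin n 1) j
  ⟦⟧-motzkin (suc n) (suc i) j = trans
    (⟦⟧-+ (M n i) ((1# + q) * M n (suc i) + q * M n (suc (suc i))) j)
    (Poly.+-cong {M n i ⟦ r ⟧} {motzkin (1# + r) r n i} (⟦⟧-motzkin n i)
      (⟦⟧-level-down (M n (suc i)) (M n (suc (suc i))) (⟦⟧-motzkin n (suc i))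
          (⟦⟧-motzkin n (suc (suc i)))) j)

  ⟦⟧-𝔑 : ∀ n → 𝔑 (n ℕ.+ 1) ⟦ r ⟧ ≈ r * motzkin (1# + r) r n 0
  ⟦⟧-𝔑 n i = trans (⟦⟧-cong (𝔑 (n ℕ.+ 1)) (q * M n 0) (𝔑≈q*motzkin n) i)
    (trans (⟦⟧-q* (M n 0) i) (Poly.*-cong {r} {r} {M n 0 ⟦ r ⟧} {motzkin (1# + r) r n 0} (λ _ → refl)
        (⟦⟧-motzkin n 0) i))

-- The three identities.

catalan-identity : ∀ n → const (catalan n)
  ≈ (∑[ k ≤ n ] const ((+ (2 ℕ.* k ℕ.+ 1) ℚ./ suc (2 ℕ.* n)) ℚ.* fromℕ ((2 ℕ.* n ℕ.+ 1) C (n ∸ k))) * 𝔑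
      k * (1# - q) ^ (n ∸ k))
catalan-identity n i = begin
  coeff (const (catalan n)) i             ≡⟨ cong (λ c → coeff (const c) i) (catalan≡ballot n) ⟩
  coeff (const (fromℕ (ballot n 1))) i    ≡⟨ const-fromℕ≈ι (ballot n 1) i ⟩
  coeff (ι (ballot n 1)) i                ≡⟨ ballot-weighted-sum n (1# - q) a 𝔑 a≈ 𝔑≈power i ⟨
  coeff (∑[ k ≤ n ] a k * 𝔑 k * (1# - q) ^ (n ∸ k)) i ∎
  where
  open ≡.≡-Reasoning
  a : ℕ → Poly
  a k = const ((+ (2 ℕ.* k ℕ.+ 1) ℚ./ suc (2 ℕ.* n)) ℚ.* fromℕ ((2 ℕ.* n ℕ.+ 1) C (n ∸ k)))

  -- The ballot parameters n - k and 2k + 1 give the same row 2n + 1 for every k, which is the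
  -- common denominator in the sum.
  index : ∀ k → k ℕ.≤ n → 2 ℕ.* (n ∸ k) ℕ.+ (2 ℕ.* k ℕ.+ 1) ≡ 2 ℕ.* n ℕ.+ 1
  index k k≤n = trans (sym (ℕ.+-assoc (2 ℕ.* (n ∸ k)) (2 ℕ.* k) 1))
    (cong (ℕ._+ 1) (trans (sym (ℕ.*-distribˡ-+ 2 (n ∸ k) k)) (cong (2 ℕ.*_) (ℕ.m∸n+n≡m k≤n))))

  ratio : ∀ k → k ℕ.≤ n → suc (2 ℕ.* n) ℕ.* ballot (n ∸ k) (2 ℕ.* k ℕ.+ 1)
      ≡ (2 ℕ.* k ℕ.+ 1) ℕ.* ((2 ℕ.* n ℕ.+ 1) C (n ∸ k))
  ratio k k≤n = trans (cong (ℕ._* ballot (n ∸ k) (2 ℕ.* k ℕ.+ 1)) (ℕ.+-comm 1 (2 ℕ.* n)))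
    (≡.subst (λ N → N ℕ.* ballot (n ∸ k) (2 ℕ.* k ℕ.+ 1) ≡ (2 ℕ.* k ℕ.+ 1) ℕ.* (N C (n ∸ k)))
        (index k k≤n) (ballot-ratio (n ∸ k) (2 ℕ.* k ℕ.+ 1)))

  a≈ : ∀ k → k ℕ.≤ n → a k ≈ ι (ballot (n ∸ k) (2 ℕ.* k ℕ.+ 1))
  a≈ k k≤n j = trans
    (cong (λ c → coeff (const c) j)
        (/-*-fromℕ-solve (2 ℕ.* k ℕ.+ 1) (2 ℕ.* n) (ballot (n ∸ k) (2 ℕ.* k ℕ.+ 1))
        ((2 ℕ.* n ℕ.+ 1) C (n ∸ k)) (ratio k k≤n)))
    (const-fromℕ≈ι (ballot (n ∸ k) (2 ℕ.* k ℕ.+ 1)) j)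

catalanHalf-even : ∀ {n} → 2 ∣ n → catalanHalf n ≡ catalan (n / 2)
catalanHalf-even {n} 2∣n = cong (λ b → if b then catalan (n / 2) else 0ℚ) (dec-true (2 ∣? n) 2∣n)

catalanHalf-odd : ∀ {n} → ¬ 2 ∣ n → catalanHalf n ≡ 0ℚ
catalanHalf-odd {n} 2∤n = cong (λ b → if b then catalan (n / 2) else 0ℚ) (dec-false (2 ∣? n) 2∤n)

-- With level weight 0 the paths are Dyck paths. For even n they have n/2 down steps and are counted
-- by a Catalan number; for odd n there are none, and on the left the rounded exponent belongs to a
-- zero coefficient.
catalanHalf≈motzkin : ∀ n → q ^ (n / 2 ℕ.+ 1) * const (catalanHalf n) ≈ q * motzkin 0# q n 0
catalanHalf≈motzkin n = parity (2 ∣? n)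
  where
  open ≡.≡-Reasoning
  m : ℕ
  m = n / 2

  parity : Dec (2 ∣ n) → q ^ (m ℕ.+ 1) * const (catalanHalf n) ≈ q * motzkin 0# q n 0
  parity (yes 2∣n) i = begin
    coeff (q ^ (m ℕ.+ 1) * const (catalanHalf n)) i
      ≡⟨ ^-+-* q m 1 {const (catalanHalf n)} {ι (ballot m 1)} half i ⟩
    coeff (q ^ 1 * (q ^ m * ι (ballot m 1))) i
      ≡⟨ Poly.*-cong {q ^ 1} {q} {q ^ m * ι (ballot m 1)} {motzkin 0# q n 0}
           (Poly.*-identityʳ q) (λ j → sym (motzkin-dyck q n m 0 n≡ j)) i ⟩
    coeff (q * motzkin 0# q n 0) i ∎
    where
    half : const (catalanHalf n) ≈ ι (ballot m 1)
    half j = trans (cong (λ c → coeff (const c) j) (trans (catalanHalf-even 2∣n) (catalan≡ballot m)))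
        (const-fromℕ≈ι (ballot m 1) j)

    n≡ : n ≡ 2 ℕ.* m ℕ.+ 0
    n≡ = sym (trans (ℕ.+-identityʳ (2 ℕ.* m)) (m*[n/m]≡n 2∣n))
  parity (no 2∤n) i = begin
    coeff (q ^ (m ℕ.+ 1) * const (catalanHalf n)) i
      ≡⟨ Poly.*-cong {q ^ (m ℕ.+ 1)} {q ^ (m ℕ.+ 1)} {const (catalanHalf n)} {0#} (λ _ → refl)
           (λ j → trans (cong (λ c → coeff (const c) j) (catalanHalf-odd 2∤n)) (const-fromℕ≈ι 0 j)) i ⟩
    coeff (q ^ (m ℕ.+ 1) * 0#) i
      ≡⟨ Poly.zeroʳ (q ^ (m ℕ.+ 1)) i ⟩
    0ℚ
      ≡⟨ Poly.zeroʳ q i ⟨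
    coeff (q * 0#) i
      ≡⟨ Poly.*-cong {q} {q} {motzkin 0# q n 0} {0#} (λ _ → refl)
           (motzkin-odd q n 0 (2∤n ∘ ≡.subst (2 ∣_) (ℕ.+-identityʳ n))) i ⟨
    coeff (q * motzkin 0# q n 0) i ∎

catalanHalf-identity : ∀ n → q ^ (n / 2 ℕ.+ 1) * const (catalanHalf n)
  ≈ (∑[ k ≤ n ] (- 1#) ^ (n ∸ k) * const (fromℕ (n C k)) * 𝔑 (k ℕ.+ 1) * (1# + q) ^ (n ∸ k))
catalanHalf-identity n i = begin
  coeff (q ^ (n / 2 ℕ.+ 1) * const (catalanHalf n)) i
    ≡⟨ catalanHalf≈motzkin n i ⟩
  coeff (q * motzkin 0# q n 0) i
    ≡⟨ Poly.*-cong {q} {q} {motzkin ((1# + q) - (1# + q)) q n 0} {motzkin 0# q n 0} (λ _ → refl)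
         (motzkin-congˡ {(1# + q) - (1# + q)} {0#} q n 0 (Poly.-‿inverseʳ (1# + q))) i ⟨
  coeff (q * motzkin ((1# + q) - (1# + q)) q n 0) i
    ≡⟨ alternating-motzkin n q (1# + q) q (1# + q) (λ k → const (fromℕ (n C k))) (λ k → 𝔑 (k ℕ.+ 1))
         (λ k → (1# + q) ^ (n ∸ k))
         (λ k → const-fromℕ≈ι (n C k)) 𝔑≈q*motzkin (λ _ _ → refl) i ⟨
  coeff (∑[ k ≤ n ] (- 1#) ^ (n ∸ k) * const (fromℕ (n C k)) * 𝔑 (k ℕ.+ 1) * (1# + q) ^ (n ∸ k)) i ∎
  where open ≡.≡-Reasoning

[1+q²]-[1-q]²≈q+q : (1# + q ^ 2) - (1# - q) ^ 2 ≈ q + q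
[1+q²]-[1-q]²≈q+q 0 = refl
[1+q²]-[1-q]²≈q+q 1 = refl
[1+q²]-[1-q]²≈q+q 2 = refl
[1+q²]-[1-q]²≈q+q (suc (suc (suc zero))) = refl
[1+q²]-[1-q]²≈q+q (suc (suc (suc (suc i)))) = refl

catalanSuc-identity : ∀ n → q ^ (n ℕ.+ 2) * const (catalan (n ℕ.+ 1))
  ≈ (∑[ k ≤ n ] (- 1#) ^ (n ∸ k) * const (fromℕ (n C k)) * 𝔑 (k ℕ.+ 1) ⟦ q ^ 2 ⟧ * (1# - q) ^
      (2 ℕ.* (n ∸ k)))
catalanSuc-identity n i = begin
  coeff (q ^ (n ℕ.+ 2) * const (catalan (n ℕ.+ 1))) i
    ≡⟨ ^-+-* q n 2 {const (catalan (n ℕ.+ 1))} {ι (ballot n 2)} catalan≈ i ⟩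
  coeff (q ^ 2 * (q ^ n * ι (ballot n 2))) i
    ≡⟨ Poly.*-cong {q ^ 2} {q ^ 2} {motzkin ((1# + q ^ 2) - (1# - q) ^ 2) (q ^ 2) n 0}
         {q ^ n * ι (ballot n 2)} (λ _ → refl)
         (λ j → trans (motzkin-congˡ {(1# + q ^ 2) - (1# - q) ^ 2} {q + q} (q ^ 2) n 0 [1+q²]-[1-q]²≈q+q j)
           (motzkin-square q n n 0 (sym (ℕ.+-identityʳ n)) j)) i ⟨
  coeff (q ^ 2 * motzkin ((1# + q ^ 2) - (1# - q) ^ 2) (q ^ 2) n 0) i
    ≡⟨ alternating-motzkin n (q ^ 2) (1# + q ^ 2) (q ^ 2) ((1# - q) ^ 2) (λ k → const (fromℕ (n C k)))
         (λ k → 𝔑 (k ℕ.+ 1) ⟦ q ^ 2 ⟧) (λ k → (1# - q) ^ (2 ℕ.* (n ∸ k)))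
         (λ k → const-fromℕ≈ι (n C k)) ⟦⟧-𝔑 (λ k j → sym (^-assocʳ Poly.semiring (1# - q) 2 (n ∸ k) j)) i ⟨
  coeff (∑[ k ≤ n ] (- 1#) ^ (n ∸ k) * const (fromℕ (n C k)) * 𝔑 (k ℕ.+ 1) ⟦ q ^ 2 ⟧ * (1# - q) ^
      (2 ℕ.* (n ∸ k))) i ∎
  where
  open ≡.≡-Reasoning
  open Substitution (q ^ 2)

  -- By C = 1 + z C², `ballot (suc n) 1` reduces to `ballot n 2`, the value that `motzkin-square`
  -- yields at height 0.
  catalan≈ : const (catalan (n ℕ.+ 1)) ≈ ι (ballot n 2)
  catalan≈ j = trans (cong (λ c → coeff (const c) j)
      (trans (cong catalan (ℕ.+-comm n 1)) (catalan≡ballot (suc n))))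
    (const-fromℕ≈ι (ballot n 2) j)

theorem1p1 : (n : ℕ) →
    (const (catalan n)
    ≈ (∑[ k ≤ n ] const ((+ (2 ℕ.* k ℕ.+ 1) ℚ./ suc (2 ℕ.* n)) ℚ.* fromℕ ((2 ℕ.* n ℕ.+ 1) C (n ∸ k))) * 𝔑 k * (1# - q) ^ (n ∸ k)))
    × (q ^ (n / 2 ℕ.+ 1) * const (catalanHalf n)
    ≈ (∑[ k ≤ n ] (- 1#) ^ (n ∸ k) * const (fromℕ (n C k)) * 𝔑 (k ℕ.+ 1) * (1# + q) ^ (n ∸ k)))
    × (q ^ (n ℕ.+ 2) * const (catalan (n ℕ.+ 1))
    ≈ (∑[ k ≤ n ] (- 1#) ^ (n ∸ k) * const (fromℕ (n C k)) * 𝔑 (k ℕ.+ 1) ⟦ q ^ 2 ⟧ * (1# - q) ^ (2 ℕ.* (n ∸ k))))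
theorem1p1 n = catalan-identity n , catalanHalf-identity n , catalanSuc-identity n
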